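{- Let $S$ be any connected shape whose nodes occupy $l$ rows and $w$ columns of the grid. Then, in the adjacency graph model with cycle-breaking growth processes and neighbor handover allowed, there is a growth process that grows $S$ from a single node in $O(\log l+\log w)$ time steps.
   Context: Shapes. Grid points are integer pairs $(x,y)$; two grid points are adjacent if they are at orthogonal (Manhattan) distance $1$. A shape $S=(V,E)$ is a finite connected graph whose nodes occupy distinct grid points and whose edges join only pairs of nodes occupying adjacent points; shapes are considered up to translation. The adjacency closure $AC(S)$ is obtained from $S$ by adding an edge between every pair of adjacent nodes that are not yet joined. Growth operations. One node, the anchor $u_0$, is stationary; other nodes move relative to it. A growth operation on a node $u$ toward an adjacent grid point $p$ either (i) if $u$ has no edge to $p$, creates a new node $u'$ at $p$ with edge $uu'$; or (ii) if $p$ is occupied by a node $v$ with $uv\in E$, creates a new node $u'$ at $p$, replaces edge $uv$ by edges $uu',u'v$, and translates by one unit, along the axis of $uv$, the part of a spanning tree rooted at $u_0$ hanging from whichever of $u,v$ is farther from $u_0$, away from the other endpoint. With neighbor handover, in addition any neighbor $w$ of $u$ lying in a direction perpendicular to $uu'$ may be handed over to $u'$ (become joined to $u'$ instead of $u$) by a unit translation parallel to $uu'$ of the subtree of whichever of $u,w$ is farther from $u_0$. In one time step a set of operations is applied concurrently, each node receiving at most one operation and all operations having the same cardinal direction; the displacement of each node is the sum of the unit vectors contributed by the operations on its path to $u_0$ in a spanning tree rooted at $u_0$. The set is collision-free if no two nodes collide during these motions or end at the same point, and for every cycle and every two of its nodes the displacements accumulated along the two paths of the cycle between them are equal. Growth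 processes. A cycle-breaking growth process in the adjacency graph model starts from $S_1^b=S_0$; in each time step $t$ it first deletes a (possibly empty) subset of edges of $S_t^b$ whose removal keeps the shape connected, then applies a collision-free set of growth operations, obtaining $S_t^e$, and sets $S_{t+1}^b=AC(S_t^e)$. It grows $S$ in $t_f$ steps if the shape after step $t_f$ is $S$. -}

module Defs where

open import Data.Bool using (Bool; T; if_then_else_)
open import Data.Bool.Properties using (T?)
open import Data.Empty using (⊥)
open import Data.Fin using (Fin; zero)
open import Data.Integer as ℤ using (ℤ; +_; ∣_∣; 0ℤ; 1ℤ; -1ℤ)
open import Data.Integer.Properties using (∣i-j∣≡∣j-i∣)
open import Data.List using (List; []; _∷_; [_]; _++_; length; map; tabulate; deduplicate)
open import Data.List.Membership.Propositional using (_∈_; _∉_)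
open import Data.List.Relation.Unary.Any using (here; there)
open import Data.List.Relation.Unary.Unique.Propositional using (Unique)
open import Data.Nat as ℕ using (ℕ; suc; NonZero)
open import Data.Product using (_×_; _,_; proj₁; proj₂)
open import Data.Product.Properties using (≡-dec)
open import Data.Sum using (_⊎_)
open import Function using (Injective; _↔_; _⇔_; Inverse)
open import Level using (0ℓ)
open import Relation.Binary using (Rel; Decidable; DecidableEquality; Symmetric)
open import Relation.Binary.Construct.Closure.ReflexiveTransitive as Star using (Star; ε; _◅_; _◅◅_)
open import Relation.Binary.PropositionalEquality using (_≡_; refl; trans; cong₂)
open import Relation.Nullary using (does; yes; no)
open import Relation.Nullary.Decidable using (_×-dec_; _⊎-dec_)

Point : Set
Point = ℤ × ℤ

infixl 6 _⊕_ _⊖_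
infixl 7 _•_ _∙_

_⊕_ _⊖_ : Point → Point → Point
(x , y) ⊕ (x′ , y′) = x ℤ.+ x′ , y ℤ.+ y′
(x , y) ⊖ (x′ , y′) = x ℤ.- x′ , y ℤ.- y′

_•_ : ℤ → Point → Point
k • (x , y) = k ℤ.* x , k ℤ.* y

_∙_ : Point → Point → ℤ
(x , y) ∙ (x′ , y′) = x ℤ.* x′ ℤ.+ y ℤ.* y′

_≟ᵖ_ : DecidableEquality Point
_≟ᵖ_ = ≡-dec ℤ._≟_ ℤ._≟_

manhattan : Point → Point → ℕ
manhattan (x , y) (x′ , y′) = ∣ x ℤ.- x′ ∣ ℕ.+ ∣ y ℤ.- y′ ∣

Adjacent : Rel Point 0ℓ
Adjacent p q = manhattan p q ≡ 1

adjacent-sym : Symmetric Adjacent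
adjacent-sym {x , y} {x′ , y′} = trans (cong₂ ℕ._+_ (∣i-j∣≡∣j-i∣ x′ x) (∣i-j∣≡∣j-i∣ y′ y))

record Shape (n : ℕ) : Set₁ where
  field
    nonempty      : NonZero n
    pos           : Fin n → Point
    pos-injective : Injective _≡_ _≡_ pos
    Edge          : Rel (Fin n) 0ℓ
    edge?         : Decidable Edge
    edge-sym      : Symmetric Edge
    edge-adjacent : ∀ {u v} → Edge u v → Adjacent (pos u) (pos v)
    connected     : ∀ u v → Star Edge u v

  columns rows : ℕ
  columns = length (deduplicate ℤ._≟_ (map proj₁ (tabulate pos)))
  rows    = length (deduplicate ℤ._≟_ (map proj₂ (tabulate pos)))

open Shape public

-- The adjacency closure.  Edges of a shape only join adjacent nodes, so adding all the
-- missing ones makes the edge relation coincide with adjacency.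
AC : ∀ {n} → Shape n → Shape n
AC S = record
  { nonempty      = nonempty S
  ; pos           = pos S
  ; pos-injective = pos-injective S
  ; Edge          = λ u v → Adjacent (pos S u) (pos S v)
  ; edge?         = λ u v → manhattan (pos S u) (pos S v) ℕ.≟ 1
  ; edge-sym      = λ {u} {v} → adjacent-sym {pos S u} {pos S v}
  ; edge-adjacent = λ e → e
  ; connected     = λ u v → Star.map (edge-adjacent S) (connected S u v)
  }

singleNode : Shape 1
singleNode = record
  { nonempty      = _
  ; pos           = λ _ → 0ℤ , 0ℤ
  ; pos-injective = λ { {zero} {zero} _ → refl }
  ; Edge          = λ _ _ → ⊥
  ; edge?         = λ _ _ → no λ ()
  ; edge-sym      = λ ()
  ; edge-adjacent = λ ()
  ; connected     = λ { zero zero → ε }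
  }

record _≅_ {m n} (S : Shape m) (S′ : Shape n) : Set where
  field
    nodes     : Fin m ↔ Fin n
    offset    : Point
    positions : ∀ u → pos S′ (Inverse.to nodes u) ≡ pos S u ⊕ offset
    edges     : ∀ u v → Edge S u v ⇔ Edge S′ (Inverse.to nodes u) (Inverse.to nodes v)

-- Rooted trees in S, built by attaching leaves one at a time; the index lists the nodes.
data RootedTree {n} (S : Shape n) (r : Fin n) : List (Fin n) → Set where
  root   : RootedTree S r [ r ]
  attach : ∀ {vs u v} → RootedTree S r vs → u ∈ vs → v ∉ vs → Edge S u v → RootedTree S r (v ∷ vs)

treePath : ∀ {n} {S : Shape n} {r vs v} → RootedTree S r vs → v ∈ vs → Star (Edge S) r v
treePath root                 (here refl) = ε
treePath (attach t u∈vs _ uv) (here refl) = treePath t u∈vs ◅◅ (uv ◅ ε)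
treePath (attach t _ _ _)     (there v∈vs) = treePath t v∈vs

record SpanningTree {n} (S : Shape n) (r : Fin n) : Set where
  field
    {nodes}  : List (Fin n)
    tree     : RootedTree S r nodes
    spanning : ∀ v → v ∈ nodes

  path : ∀ v → Star (Edge S) r v
  path v = treePath tree (spanning v)

data Direction : Set where
  north south east west : Direction

⟦_⟧ : Direction → Point
⟦ north ⟧ = 0ℤ , 1ℤ
⟦ south ⟧ = 0ℤ , -1ℤ
⟦ east  ⟧ = 1ℤ , 0ℤ
⟦ west  ⟧ = -1ℤ , 0ℤ

-- A set of concurrent operations: `grows u` says that u receives an operation, and
-- `handover u w` that this operation hands the neighbour w over to the new node.  The
-- latter only has an effect if u grows and w is a neighbour of u in a perpendicular direction.
record Operations (n : ℕ) : Set where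
  field
    direction : Direction
    grows     : Fin n → Bool
    handover  : Fin n → Fin n → Bool

open Operations public

-- new u _ is the node generated by u.
data Node {n} (ops : Operations n) : Set where
  old : Fin n → Node ops
  new : (u : Fin n) → T (grows ops u) → Node ops

sources targets : ∀ {n} {E : Rel (Fin n) 0ℓ} {u v} → Star E u v → List (Fin n)
sources ε                  = []
sources (_◅_ {i = u} _ es) = u ∷ sources es
targets ε                  = []
targets (_◅_ {j = v} _ es) = v ∷ targets es

module Motion {n} (S : Shape n) (ops : Operations n) where

  d : Point
  d = ⟦ direction ops ⟧

  -- For an edge uv: the operation on u attaches v to the new node u′ instead of u, either
  -- because u grows toward v, so that uv is replaced by uu′ and u′v, or by handover.
  Reattached : Fin n → Fin n → Set
  Reattached u v = T (grows ops u) ×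
    (pos S v ≡ pos S u ⊕ d ⊎ ((pos S v ⊖ pos S u) ∙ d ≡ 0ℤ × T (handover ops u v)))

  reattached? : Decidable Reattached
  reattached? u v = T? _ ×-dec
    ((pos S v ≟ᵖ (pos S u ⊕ d)) ⊎-dec ((((pos S v ⊖ pos S u) ∙ d) ℤ.≟ 0ℤ) ×-dec T? _))

  push : Fin n → Fin n → ℤ
  push u v = if does (reattached? u v) then 1ℤ else 0ℤ

  -- All displacements are along the common axis and are measured in units of d.
  -- contribution u v is the displacement of v relative to u over an edge uv: an operation
  -- on u that reattaches v translates v by d if v is the farther from the anchor; if u is
  -- the farther it translates u by - d, so that contribution v u is the opposite.
  contribution : Fin n → Fin n → ℤ
  contribution u v = push u v ℤ.- push v u

  accumulated : ∀ {u v} → Star (Edge S) u v → ℤ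
  accumulated ε                          = 0ℤ
  accumulated (_◅_ {i = u} {j = v} _ es) = contribution u v ℤ.+ accumulated es

  -- The nodes of the closed walk made of p and the reverse of q are those of
  -- sources p ++ targets q, each listed once per visit; it is a cycle when they are distinct.
  NoCycleCollision : Set
  NoCycleCollision = ∀ {u v} (p q : Star (Edge S) u v) →
    Unique (sources p ++ targets q) → accumulated p ≡ accumulated q

  attachment : Fin n → Fin n → Node ops
  attachment u v with reattached? u v
  ... | yes (g , _) = new u g
  ... | no  _       = old u

  data NewEdge : Rel (Node ops) 0ℓ where
    kept      : ∀ {u v} → Edge S u v → NewEdge (attachment u v) (attachment v u)
    generated : ∀ {u} (g : T (grows ops u)) → NewEdge (old u) (new u g)
    generator : ∀ {u} (g : T (grows ops u)) → NewEdge (new u g) (old u)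

  module _ {u₀ : Fin n} (tree : SpanningTree S u₀) where

    displacement : Fin n → ℤ
    displacement u = accumulated (SpanningTree.path tree u)

    start : Node ops → Point
    start (old u)   = pos S u
    start (new u _) = pos S u

    -- A new node emerges from its generator u and ends one unit ahead of it.
    shift : Node ops → ℤ
    shift (old u)   = displacement u
    shift (new u _) = displacement u ℤ.+ 1ℤ

    final : Node ops → Point
    final a = start a ⊕ shift a • d

    -- The position at time p / q of the uniform motion over the time interval [0,1],
    -- scaled by q.  Rational times suffice, as start and shift are integral.
    scaledPosition : (p q : ℕ) → Node ops → Point
    scaledPosition p q a = (+ q) • start a ⊕ (+ p ℤ.* shift a) • d

    -- Time 0 is excluded, since a new node then still coincides with its generator;
    -- p = q is the end of the motion.
    NoNodeCollision : Set
    NoNodeCollision = ∀ p q → 0 ℕ.< p → p ℕ.≤ q → Injective _≡_ _≡_ (scaledPosition p q)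

record Growth {n m} (S : Shape n) (u₀ : Fin n) (S′ : Shape m) (u₀′ : Fin m) : Set where
  field
    ops  : Operations n
    tree : SpanningTree S u₀
  open Motion S ops
  field
    noNodeCollision  : NoNodeCollision tree
    noCycleCollision : NoCycleCollision
    nodes            : Node ops ↔ Fin m
    anchor           : Inverse.to nodes (old u₀) ≡ u₀′
    positions        : ∀ a → pos S′ (Inverse.to nodes a) ≡ final tree a
    edges            : ∀ a b → Edge S′ (Inverse.to nodes a) (Inverse.to nodes b) ⇔ NewEdge a b

record EdgeDeletion {n} (S S′ : Shape n) : Set where
  field
    positions : ∀ u → pos S′ u ≡ pos S u
    edges     : ∀ {u v} → Edge S′ u v → Edge S u v

-- That the deletion keeps the shape connected is part of Sᵈ being a shape.
record TimeStep {n m} (Sᵇ : Shape n) (u₀ : Fin n) (Sᵉ : Shape m) (u₀′ : Fin m) : Set₁ where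
  field
    Sᵈ       : Shape n
    deletion : EdgeDeletion Sᵇ Sᵈ
    growth   : Growth Sᵈ u₀ Sᵉ u₀′

-- Process S₀ u₀ t Sᵇ u: after t time steps the process is about to perform step t + 1 on
-- Sᵇ; the second node argument is the anchor as a node of Sᵇ.
data Process {n₀} (S₀ : Shape n₀) (u₀ : Fin n₀) : ℕ → ∀ {n} → Shape n → Fin n → Set₁ where
  start : Process S₀ u₀ 0 S₀ u₀
  next  : ∀ {t n m} {Sᵇ : Shape n} {Sᵉ : Shape m} {u u′} →
          Process S₀ u₀ t Sᵇ u → TimeStep Sᵇ u Sᵉ u′ → Process S₀ u₀ (suc t) (AC Sᵉ) u′

-- GrowsIn S₀ S t: some process grows S from S₀ in t steps.  The shape after a step is the
-- one at the end of that step, before the adjacency closure that begins the next step.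
data GrowsIn {n₀ k} (S₀ : Shape n₀) (S : Shape k) : ℕ → Set₁ where
  immediately : S₀ ≅ S → GrowsIn S₀ S 0
  by          : ∀ {t n m} {Sᵇ : Shape n} {Sᵉ : Shape m} {u u′} (u₀ : Fin n₀) →
                Process S₀ u₀ t Sᵇ u → TimeStep Sᵇ u Sᵉ u′ → Sᵉ ≅ S → GrowsIn S₀ S (suc t)

{-# OPTIONS --safe #-}
module Submission where

open import Defs
open import Data.Bool using (Bool; true; false; T; if_then_else_; not; _∧_)
import Data.Bool.Properties as Boolₚ
open import Data.Bool.Properties using (T-irrelevant; T-∧)
open import Data.Empty using (⊥; ⊥-elim)
open import Data.Fin as Fin using (Fin; zero; suc)
import Data.Fin.Properties as Finₚ
open import Data.Fin.Properties using (any?)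
open import Data.Integer as ℤ using (ℤ; +_; -[1+_]; ∣_∣; 0ℤ; 1ℤ; -1ℤ)
open import Data.Integer.DivMod using (a≡a%ℕn+[a/ℕn]*n; n%ℕd<d)
import Data.Integer.Properties as ℤₚ
open import Data.Integer.Tactic.RingSolver using (solve-∀)
open import Data.List using (List; []; _∷_; allFin; length; lookup; map; tabulate; deduplicate)
import Data.List.Membership.DecPropositional as DecMembership
open import Data.List.Membership.Propositional using (_∈_)
open import Data.List.Membership.Propositional.Properties
  using (∈-allFin; ∈-lookup; ∈-map⁺; ∈-map⁻; ∈-tabulate⁺; ∈-tabulate⁻; ∈-deduplicate⁺; ∈-deduplicate⁻)
import Data.List.Relation.Unary.All as All
open import Data.List.Relation.Unary.AllPairs using (_∷_)
open import Data.List.Relation.Unary.Any using (here; there; index)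
open import Data.List.Relation.Unary.Any.Properties using (lookup-index)
open import Data.List.Relation.Unary.Unique.DecPropositional.Properties using (deduplicate-!)
open import Data.List.Relation.Unary.Unique.Propositional using (Unique)
import Data.Nat as ℕ
open import Data.Nat using (ℕ; zero; suc; NonZero; _+_; _*_; _^_; _≤_; _<_; s≤s; z≤n)
open import Data.Nat.DivMod using (m<n*o⇒m/o<n)
open import Data.Nat.Logarithm using (⌊log₂_⌋; ⌊log₂⌋-mono-≤; ⌊log₂[2^n]⌋≡n)
import Data.Nat.Properties as ℕₚ
import Data.Nat.Tactic.RingSolver as ℕ-Solver
open import Data.Product using (∃; _×_; _,_; proj₁; proj₂)
open import Data.Sum using (_⊎_; inj₁; inj₂)
open import Function using (_↔_; mk↔ₛ′; mk⇔; Inverse; Injective; _∘_; id; Equivalence)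
open import Function.Construct.Identity using (↔-id)
open import Relation.Binary using (Decidable; DecidableEquality)
open import Relation.Binary.Construct.Closure.ReflexiveTransitive as Star using (Star; ε; _◅_; _◅◅_)
open import Relation.Binary.PropositionalEquality
open import Relation.Nullary using (Dec; yes; no; ¬_)
open import Relation.Nullary.Decidable using (_×-dec_; map′; dec-true; dec-false; ⌊_⌋; toWitness)

open import Algebra.Properties.AbelianGroup ℤₚ.+-0-abelianGroup
  using () renaming (∙-cancelʳ to +-cancelʳ; ∙-cancelˡ to +-cancelˡ)

-- Read the growth backwards.  Halving the y-coordinates of all nodes (rounding down) merges the
-- rows 2i and 2i + 1 into row i; after about log l such steps, and about log w steps on the
-- x-coordinates, a single node is left.  Each halving is undone by one time step.  A merged cell
-- is occupied in its lower row, in its upper row, or in both; the cells of the last kind grow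
-- north.  Let φ be the row of a cell plus 1 if only its upper row is occupied: this is the
-- distance that the old node of the cell has to move.  A cell that grows hands over exactly its
-- neighbours without a lower node.  Then every coarse edge that comes from an edge of the finer
-- shape contributes the difference of φ at its ends, so after deletion of the other edges the
-- shape is still connected, all displacements are differences of φ, and cycles agree.  Nodes do
-- not collide, since those of row i all move by i or i + 1.  A last step without operations
-- deletes the superfluous edges.

-- Spanning trees of connected shapes.

module _ {n} (S : Shape n) where

  open DecMembership (Fin._≟_ {n}) using (_∈?_)

  -- Follow the walk and attach each node that the tree does not contain yet by the edge just
  -- traversed. The inclusion of the old node list is returned so that memberships established
  -- earlier survive further extensions.
  extendAlong : ∀ {r vs u v} → RootedTree S r vs → u ∈ vs → Star (Edge S) u v →
    ∃ λ vs′ → RootedTree S r vs′ × (∀ {w} → w ∈ vs → w ∈ vs′) × v ∈ vs′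
  extendAlong t u∈vs ε = _ , t , (λ w∈vs → w∈vs) , u∈vs
  extendAlong {vs = vs} t u∈vs (_◅_ {j = w} e es) with w ∈? vs
  ... | yes w∈vs = extendAlong t w∈vs es
  ... | no  w∉vs with extendAlong (attach t u∈vs w∉vs e) (here refl) es
  ...   | vs′ , t′ , vs⊆vs′ , v∈vs′ = vs′ , t′ , vs⊆vs′ ∘ there , v∈vs′

  treeThrough : ∀ r ws → ∃ λ vs → RootedTree S r vs × r ∈ vs × (∀ {w} → w ∈ ws → w ∈ vs)
  treeThrough r []       = _ , root , here refl , λ ()
  treeThrough r (w ∷ ws) with treeThrough r ws
  ... | vs , t , r∈vs , ws⊆vs with extendAlong t r∈vs (connected S r w)
  ...   | vs′ , t′ , vs⊆vs′ , w∈vs′ =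
    vs′ , t′ , vs⊆vs′ r∈vs , λ { (here refl) → w∈vs′ ; (there x∈ws) → vs⊆vs′ (ws⊆vs x∈ws) }

  spanningTree : ∀ r → SpanningTree S r
  spanningTree r with treeThrough r (allFin n)
  ... | _ , t , _ , all⊆ = record { tree = t ; spanning = λ v → all⊆ (∈-allFin v) }

-- Arithmetic of grid points and their distance.

•-identityˡ : ∀ p → 1ℤ • p ≡ p
•-identityˡ (x , y) = cong₂ _,_ (ℤₚ.*-identityˡ x) (ℤₚ.*-identityˡ y)

•-cancelˡ : ∀ k .{{_ : ℤ.NonZero k}} {p q} → k • p ≡ k • q → p ≡ q
•-cancelˡ k eq = cong₂ _,_ (ℤₚ.*-cancelˡ-≡ k _ _ (cong proj₁ eq)) (ℤₚ.*-cancelˡ-≡ k _ _ (cong proj₂ eq))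

⊕-assoc : ∀ p q r → p ⊕ q ⊕ r ≡ p ⊕ (q ⊕ r)
⊕-assoc (x , y) (x′ , y′) (x″ , y″) = cong₂ _,_ (ℤₚ.+-assoc x x′ x″) (ℤₚ.+-assoc y y′ y″)

⊕-cancelʳ : ∀ o {p q} → p ⊕ o ≡ q ⊕ o → p ≡ q
⊕-cancelʳ (x , y) eq = cong₂ _,_ (+-cancelʳ x _ _ (cong proj₁ eq)) (+-cancelʳ y _ _ (cong proj₂ eq))

manhattan-translate : ∀ p q o → manhattan (p ⊕ o) (q ⊕ o) ≡ manhattan p q
manhattan-translate (x , y) (x′ , y′) (a , b) =
  cong₂ (λ i j → ∣ i ∣ + ∣ j ∣) (cancel x x′ a) (cancel y y′ b)
  where
  cancel : ∀ x x′ a → (x ℤ.+ a) ℤ.- (x′ ℤ.+ a) ≡ x ℤ.- x′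
  cancel = solve-∀

adjacent-successive : ∀ p k dir → Adjacent (p ⊕ k • ⟦ dir ⟧) (p ⊕ (k ℤ.+ 1ℤ) • ⟦ dir ⟧)
adjacent-successive (x , y) k dir = trans
  (cong₂ (λ i j → ∣ i ∣ + ∣ j ∣) (difference x k (proj₁ ⟦ dir ⟧)) (difference y k (proj₂ ⟦ dir ⟧)))
  (unit dir)
  where
  difference : ∀ x k a → (x ℤ.+ k ℤ.* a) ℤ.- (x ℤ.+ (k ℤ.+ 1ℤ) ℤ.* a) ≡ ℤ.- a
  difference = solve-∀
  unit : ∀ dir → ∣ ℤ.- proj₁ ⟦ dir ⟧ ∣ + ∣ ℤ.- proj₂ ⟦ dir ⟧ ∣ ≡ 1
  unit north = refl
  unit south = refl
  unit east  = refl
  unit west  = refl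

-- Growth operations governed by a potential.

module _ {n} (S : Shape n) (ops : Operations n) where

  open Motion S ops

  push-yes : ∀ {u v} → Reattached u v → push u v ≡ 1ℤ
  push-yes r = cong (if_then 1ℤ else 0ℤ) (dec-true (reattached? _ _) r)

  push-no : ∀ {u v} → ¬ Reattached u v → push u v ≡ 0ℤ
  push-no ¬r = cong (if_then 1ℤ else 0ℤ) (dec-false (reattached? _ _) ¬r)

-- If the contribution of every edge is a difference of values of φ, accumulated displacements
-- depend only on the endpoints of a walk.
module PotentialGrowth {n} (S : Shape n) (ops : Operations n) (u₀ : Fin n) (φ : Fin n → ℤ)
    (potential : ∀ {u v} → Edge S u v → Motion.contribution S ops u v ≡ φ v ℤ.- φ u) where

  open Motion S ops

  tree : SpanningTree S u₀
  tree = spanningTree S u₀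

  accumulated-potential : ∀ {u v} (p : Star (Edge S) u v) → accumulated p ≡ φ v ℤ.- φ u
  accumulated-potential {u} ε = sym (ℤₚ.+-inverseʳ (φ u))
  accumulated-potential {u} {v} (_◅_ {j = w} e es) =
    trans (cong₂ ℤ._+_ (potential e) (accumulated-potential es)) (telescope (φ u) (φ w) (φ v))
    where
    telescope : ∀ a b c → (b ℤ.- a) ℤ.+ (c ℤ.- b) ≡ c ℤ.- a
    telescope = solve-∀

  displacement-potential : ∀ u → displacement tree u ≡ φ u ℤ.- φ u₀
  displacement-potential u = accumulated-potential (SpanningTree.path tree u)

  -- By `final-attachment`, the two sides are the shifts of the nodes between which the edge `uv`
  -- survives. Their equality means that the surviving edge is translated rigidly and hence still
  -- joins adjacent points.
  displacement-push : ∀ {u v} → Edge S u v →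
    displacement tree u ℤ.+ push u v ≡ displacement tree v ℤ.+ push v u
  displacement-push {u} {v} e = begin
    displacement tree u ℤ.+ push u v                  ≡⟨ cong (ℤ._+ push u v) (displacement-potential u) ⟩
    (φ u ℤ.- φ u₀) ℤ.+ push u v                       ≡⟨ split (φ u) (φ u₀) (push u v) (push v u) ⟩
    (φ u ℤ.- φ u₀) ℤ.+ (contribution u v ℤ.+ push v u) ≡⟨ cong (λ c → (φ u ℤ.- φ u₀) ℤ.+ (c ℤ.+ push v u)) (potential e) ⟩
    (φ u ℤ.- φ u₀) ℤ.+ ((φ v ℤ.- φ u) ℤ.+ push v u)     ≡⟨ merge (φ u) (φ u₀) (φ v) (push v u) ⟩
    (φ v ℤ.- φ u₀) ℤ.+ push v u                       ≡⟨ cong (ℤ._+ push v u) (displacement-potential v) ⟨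
    displacement tree v ℤ.+ push v u                  ∎
    where
    open ≡-Reasoning
    split : ∀ a b c e → (a ℤ.- b) ℤ.+ c ≡ (a ℤ.- b) ℤ.+ ((c ℤ.- e) ℤ.+ e)
    split = solve-∀
    merge : ∀ a b c e → (a ℤ.- b) ℤ.+ ((c ℤ.- a) ℤ.+ e) ≡ (c ℤ.- b) ℤ.+ e
    merge = solve-∀

  final-attachment : ∀ u v →
    final tree (attachment u v) ≡ pos S u ⊕ (displacement tree u ℤ.+ push u v) • d
  final-attachment u v with reattached? u v
  ... | yes r = cong (λ k → pos S u ⊕ (displacement tree u ℤ.+ k) • d) (sym (push-yes S ops r))
  ... | no ¬r = cong (λ k → pos S u ⊕ k • d) (sym (trans
    (cong (λ k → displacement tree u ℤ.+ k) (push-no S ops ¬r)) (ℤₚ.+-identityʳ (displacement tree u))))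

  newEdge-adjacent : ∀ {a b} → NewEdge a b → Adjacent (final tree a) (final tree b)
  newEdge-adjacent (kept {u} {v} e) = subst₂ Adjacent
    (trans (cong (λ k → pos S u ⊕ k • d) (sym (displacement-push e))) (sym (final-attachment u v)))
    (sym (final-attachment v u))
    (trans (manhattan-translate (pos S u) (pos S v) ((displacement tree v ℤ.+ push v u) • d)) (edge-adjacent S e))
  newEdge-adjacent (generated {u} _) = adjacent-successive (pos S u) (displacement tree u) (direction ops)
  newEdge-adjacent (generator {u} _) =
    adjacent-sym {pos S u ⊕ displacement tree u • d} {pos S u ⊕ (displacement tree u ℤ.+ 1ℤ) • d}
      (adjacent-successive (pos S u) (displacement tree u) (direction ops))

  newEdge-sym : ∀ {a b} → NewEdge a b → NewEdge b a
  newEdge-sym (kept e)      = kept (edge-sym S e)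
  newEdge-sym (generated g) = generator g
  newEdge-sym (generator g) = generated g

  fromAttachment : ∀ u v → Star NewEdge (attachment u v) (old u)
  fromAttachment u v with reattached? u v
  ... | yes (g , _) = generator g ◅ ε
  ... | no  _       = ε

  -- An edge `uv` survives between `attachment u v` and `attachment v u`, and each of these is the
  -- old node itself or one generator edge away from it.
  connected-old : ∀ {u v} → Star (Edge S) u v → Star NewEdge (old u) (old v)
  connected-old ε = ε
  connected-old {u} (_◅_ {j = w} e es) =
    Star.reverse newEdge-sym (fromAttachment u w) ◅◅ (kept e ◅ fromAttachment w u) ◅◅ connected-old es

  generatorOf : Node ops → Fin n
  generatorOf (old u)   = u
  generatorOf (new u _) = u

  toGenerator : ∀ a → Star NewEdge a (old (generatorOf a))
  toGenerator (old u)   = ε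
  toGenerator (new u g) = generator g ◅ ε

  newEdge-connected : ∀ a b → Star NewEdge a b
  newEdge-connected a b = toGenerator a
    ◅◅ connected-old (connected S (generatorOf a) (generatorOf b))
    ◅◅ Star.reverse newEdge-sym (toGenerator b)

  _≟ⁿ_ : DecidableEquality (Node ops)
  old u   ≟ⁿ old v   = map′ (cong old) (λ { refl → refl }) (u Fin.≟ v)
  old u   ≟ⁿ new v _ = no λ ()
  new u _ ≟ⁿ old v   = no λ ()
  new u g ≟ⁿ new v h with u Fin.≟ v
  ... | yes refl = yes (cong (new u) (T-irrelevant g h))
  ... | no  u≢v  = no λ { refl → u≢v refl }

  -- The constructor `kept` with its indices turned into equations, so that it can be decided by
  -- searching all pairs of nodes.
  Kept : Node ops → Node ops → Set
  Kept a b = ∃ λ u → ∃ λ v → Edge S u v × attachment u v ≡ a × attachment v u ≡ b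

  kept? : Decidable Kept
  kept? a b = any? λ u → any? λ v →
    edge? S u v ×-dec ((attachment u v ≟ⁿ a) ×-dec (attachment v u ≟ⁿ b))

  newEdge? : Decidable NewEdge
  newEdge? a b with kept? a b
  newEdge? a b | yes (u , v , e , refl , refl) = yes (kept e)
  newEdge? (old u) (new v g) | no ¬k with u Fin.≟ v
  ... | yes refl = yes (generated g)
  ... | no  u≢v  = no λ e → absurd e refl refl
    where
    -- The endpoints are generalised to variables with equations because unification cannot invert
    -- the function `attachment` in the indices of `kept`.
    absurd : ∀ {a b} → NewEdge a b → a ≡ old u → b ≡ new v g → ⊥
    absurd (kept e)      p    q    = ¬k (_ , _ , e , p , q)
    absurd (generated _) refl refl = u≢v refl
  newEdge? (new u g) (old v) | no ¬k with u Fin.≟ v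
  ... | yes refl = yes (generator g)
  ... | no  u≢v  = no λ e → absurd e refl refl
    where
    absurd : ∀ {a b} → NewEdge a b → a ≡ new u g → b ≡ old v → ⊥
    absurd (kept e)      p    q    = ¬k (_ , _ , e , p , q)
    absurd (generator _) refl refl = u≢v refl
  newEdge? (old u) (old v) | no ¬k = no λ e → absurd e refl refl
    where
    absurd : ∀ {a b} → NewEdge a b → a ≡ old u → b ≡ old v → ⊥
    absurd (kept e) p q = ¬k (_ , _ , e , p , q)
  newEdge? (new u g) (new v h) | no ¬k = no λ e → absurd e refl refl
    where
    absurd : ∀ {a b} → NewEdge a b → a ≡ new u g → b ≡ new v h → ⊥
    absurd (kept e) p q = ¬k (_ , _ , e , p , q)

  module Result {m} (nodes : Node ops ↔ Fin m) (noCollision : NoNodeCollision tree) where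

    open Inverse nodes using (to; from; strictlyInverseˡ; strictlyInverseʳ)

    scaledPosition-1-1 : ∀ a → scaledPosition tree 1 1 a ≡ final tree a
    scaledPosition-1-1 a = cong₂ (λ p k → p ⊕ k • d)
      (•-identityˡ (Motion.start S ops tree a)) (ℤₚ.*-identityˡ (shift tree a))

    final-injective : Injective _≡_ _≡_ (final tree)
    final-injective {a} {b} eq = noCollision 1 1 (s≤s z≤n) (s≤s z≤n)
      (trans (scaledPosition-1-1 a) (trans eq (sym (scaledPosition-1-1 b))))

    shape : Shape m
    shape = record
      { nonempty      = inhabited (to (old u₀))
      ; pos           = final tree ∘ from
      ; pos-injective = λ {a} {b} eq →
          trans (sym (strictlyInverseˡ a)) (trans (cong to (final-injective eq)) (strictlyInverseˡ b))
      ; Edge          = λ a b → NewEdge (from a) (from b)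
      ; edge?         = λ a b → newEdge? (from a) (from b)
      ; edge-sym      = newEdge-sym
      ; edge-adjacent = newEdge-adjacent
      ; connected     = λ a b → subst₂ (Star _) (strictlyInverseˡ a) (strictlyInverseˡ b)
          (Star.gmap to (λ {x} {y} → subst₂ NewEdge (sym (strictlyInverseʳ x)) (sym (strictlyInverseʳ y)))
            (newEdge-connected (from a) (from b)))
      }
      where
      inhabited : ∀ {m} → Fin m → NonZero m
      inhabited zero    = _
      inhabited (suc _) = _

    growth : Growth S u₀ shape (to (old u₀))
    growth = record
      { ops              = ops
      ; tree             = tree
      ; noNodeCollision  = noCollision
      ; noCycleCollision = λ p q _ → trans (accumulated-potential p) (sym (accumulated-potential q))
      ; nodes            = nodes
      ; anchor           = refl
      ; positions        = λ a → cong (final tree) (strictlyInverseʳ a)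
      ; edges            = λ a b → mk⇔
          (subst₂ NewEdge (strictlyInverseʳ a) (strictlyInverseʳ b))
          (subst₂ NewEdge (sym (strictlyInverseʳ a)) (sym (strictlyInverseʳ b)))
      }

-- Coordinates along and across an axis.

data Axis : Set where
  vertical horizontal : Axis

along across : Axis → Point → ℤ
along  vertical   = proj₂
along  horizontal = proj₁
across vertical   = proj₁
across horizontal = proj₂

forward : Axis → Direction
forward vertical   = north
forward horizontal = east

point-≡ : ∀ ax {p q} → along ax p ≡ along ax q → across ax p ≡ across ax q → p ≡ q
point-≡ vertical   a c = cong₂ _,_ c a
point-≡ horizontal a c = cong₂ _,_ a c

along-⊕ : ∀ ax p q → along ax (p ⊕ q) ≡ along ax p ℤ.+ along ax q
along-⊕ vertical   _ _ = refl
along-⊕ horizontal _ _ = refl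

across-⊕ : ∀ ax p q → across ax (p ⊕ q) ≡ across ax p ℤ.+ across ax q
across-⊕ vertical   _ _ = refl
across-⊕ horizontal _ _ = refl

along-• : ∀ ax k p → along ax (k • p) ≡ k ℤ.* along ax p
along-• vertical   _ _ = refl
along-• horizontal _ _ = refl

across-• : ∀ ax k p → across ax (k • p) ≡ k ℤ.* across ax p
across-• vertical   _ _ = refl
across-• horizontal _ _ = refl

along-forward : ∀ ax p k → along ax (p ⊕ k • ⟦ forward ax ⟧) ≡ along ax p ℤ.+ k
along-forward vertical   p k = cong (λ i → proj₂ p ℤ.+ i) (ℤₚ.*-identityʳ k)
along-forward horizontal p k = cong (λ i → proj₁ p ℤ.+ i) (ℤₚ.*-identityʳ k)

across-forward : ∀ ax p k → across ax (p ⊕ k • ⟦ forward ax ⟧) ≡ across ax p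
across-forward vertical   p k = trans (cong (λ i → proj₁ p ℤ.+ i) (ℤₚ.*-zeroʳ k)) (ℤₚ.+-identityʳ _)
across-forward horizontal p k = trans (cong (λ i → proj₂ p ℤ.+ i) (ℤₚ.*-zeroʳ k)) (ℤₚ.+-identityʳ _)

along-next : ∀ ax p → along ax (p ⊕ ⟦ forward ax ⟧) ≡ along ax p ℤ.+ 1ℤ
along-next vertical   p = refl
along-next horizontal p = refl

across-next : ∀ ax p → across ax (p ⊕ ⟦ forward ax ⟧) ≡ across ax p
across-next vertical   p = ℤₚ.+-identityʳ _
across-next horizontal p = ℤₚ.+-identityʳ _

difference-forward : ∀ ax p q → (p ⊖ q) ∙ ⟦ forward ax ⟧ ≡ along ax p ℤ.- along ax q
difference-forward vertical   (x , y) (x′ , y′) = lemma x y x′ y′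
  where
  lemma : ∀ x y x′ y′ → (x ℤ.- x′) ℤ.* 0ℤ ℤ.+ (y ℤ.- y′) ℤ.* 1ℤ ≡ y ℤ.- y′
  lemma = solve-∀
difference-forward horizontal (x , y) (x′ , y′) = lemma x y x′ y′
  where
  lemma : ∀ x y x′ y′ → (x ℤ.- x′) ℤ.* 1ℤ ℤ.+ (y ℤ.- y′) ℤ.* 0ℤ ≡ x ℤ.- x′
  lemma = solve-∀

manhattan-along-across : ∀ ax p q →
  manhattan p q ≡ ∣ along ax p ℤ.- along ax q ∣ + ∣ across ax p ℤ.- across ax q ∣
manhattan-along-across vertical   p q = ℕₚ.+-comm ∣ proj₁ p ℤ.- proj₁ q ∣ _
manhattan-along-across horizontal p q = refl

data Neighbours (ax : Axis) (p q : Point) : Set where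
  ahead  : along ax q ≡ along ax p ℤ.+ 1ℤ → across ax p ≡ across ax q → Neighbours ax p q
  behind : along ax p ≡ along ax q ℤ.+ 1ℤ → across ax p ≡ across ax q → Neighbours ax p q
  beside : along ax p ≡ along ax q → ∣ across ax p ℤ.- across ax q ∣ ≡ 1 → Neighbours ax p q

i+1-i≡1 : ∀ i → (i ℤ.+ 1ℤ) ℤ.- i ≡ 1ℤ
i+1-i≡1 = solve-∀

i-[i+1]≡-1 : ∀ i → i ℤ.- (i ℤ.+ 1ℤ) ≡ -1ℤ
i-[i+1]≡-1 = solve-∀

adjacent⇒neighbours : ∀ ax p q → Adjacent p q → Neighbours ax p q
adjacent⇒neighbours ax p q adj =
  classify (along ax p ℤ.- along ax q) refl (trans (sym (manhattan-along-across ax p q)) adj)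
  where
  split : ∀ i j → i ≡ j ℤ.+ (i ℤ.- j)
  split = solve-∀
  split′ : ∀ i j → j ≡ i ℤ.+ (ℤ.- (i ℤ.- j))
  split′ = solve-∀
  classify : ∀ k → along ax p ℤ.- along ax q ≡ k → ∣ k ∣ + ∣ across ax p ℤ.- across ax q ∣ ≡ 1 →
    Neighbours ax p q
  classify (+ 0) eq far = beside (ℤₚ.i-j≡0⇒i≡j _ _ eq) far
  classify (+ 1) eq far = behind
    (trans (split (along ax p) (along ax q)) (cong (λ k → along ax q ℤ.+ k) eq))
    (ℤₚ.i-j≡0⇒i≡j _ _ (ℤₚ.∣i∣≡0⇒i≡0 (ℕₚ.suc-injective far)))
  classify -[1+ 0 ] eq far = ahead
    (trans (split′ (along ax p) (along ax q)) (cong (λ k → along ax p ℤ.+ ℤ.- k) eq))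
    (ℤₚ.i-j≡0⇒i≡j _ _ (ℤₚ.∣i∣≡0⇒i≡0 (ℕₚ.suc-injective far)))
  classify (+ suc (suc _)) eq ()
  classify -[1+ suc _ ]    eq ()

neighbours⇒adjacent : ∀ ax p q → Neighbours ax p q → Adjacent p q
neighbours⇒adjacent ax p q nb = trans (manhattan-along-across ax p q) (distance nb)
  where
  distance : Neighbours ax p q → ∣ along ax p ℤ.- along ax q ∣ + ∣ across ax p ℤ.- across ax q ∣ ≡ 1
  distance (ahead  a c) rewrite a | c | i-[i+1]≡-1 (along ax p) | ℤₚ.+-inverseʳ (across ax q) = refl
  distance (behind a c) rewrite a | c | i+1-i≡1 (along ax q) | ℤₚ.+-inverseʳ (across ax q) = refl
  distance (beside a c) rewrite a | c | ℤₚ.+-inverseʳ (along ax q) = refl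

-- Halving a coordinate: quotients, remainders and adjacency.

bit : Bool → ℤ
bit true  = 1ℤ
bit false = 0ℤ

-- With q = p = 1 this is uniqueness of division by 2; in general, rows that move by i or i + 1,
-- where i is the number of the row, do not meet.
scaled-separated : ∀ p q → 0 < p → 0 < q → ∀ i j e e′ →
  + q ℤ.* i ℤ.+ + p ℤ.* (i ℤ.+ bit e) ≡ + q ℤ.* j ℤ.+ + p ℤ.* (j ℤ.+ bit e′) → i ≡ j × e ≡ e′
scaled-separated p q 0<p 0<q i j e e′ eq = conclude e e′ difference
  where
  open ≡-Reasoning
  collect : ∀ p q i j b b′ → (q ℤ.+ p) ℤ.* (i ℤ.- j) ≡
    (q ℤ.* i ℤ.+ p ℤ.* (i ℤ.+ b)) ℤ.- (q ℤ.* j ℤ.+ p ℤ.* (j ℤ.+ b′)) ℤ.+ p ℤ.* (b′ ℤ.- b)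
  collect = solve-∀
  -- The right-hand side is `0` or `p`. In the first case `i` and `j` agree; the second is
  -- impossible, since `p` is positive and smaller than `q + p`, hence not a multiple of it.
  difference : (q + p) * ∣ i ℤ.- j ∣ ≡ p * ∣ bit e′ ℤ.- bit e ∣
  difference = begin
    (q + p) * ∣ i ℤ.- j ∣                ≡⟨ ℤₚ.abs-* (+ (q + p)) (i ℤ.- j) ⟨
    ∣ (+ q ℤ.+ + p) ℤ.* (i ℤ.- j) ∣      ≡⟨ cong ∣_∣ (collect (+ p) (+ q) i j (bit e) (bit e′)) ⟩
    ∣ (+ q ℤ.* i ℤ.+ + p ℤ.* (i ℤ.+ bit e)) ℤ.- (+ q ℤ.* j ℤ.+ + p ℤ.* (j ℤ.+ bit e′))
        ℤ.+ + p ℤ.* (bit e′ ℤ.- bit e) ∣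
      ≡⟨ cong (λ k → ∣ k ℤ.+ + p ℤ.* (bit e′ ℤ.- bit e) ∣) (ℤₚ.i≡j⇒i-j≡0 eq) ⟩
    ∣ 0ℤ ℤ.+ + p ℤ.* (bit e′ ℤ.- bit e) ∣ ≡⟨ cong ∣_∣ (ℤₚ.+-identityˡ (+ p ℤ.* (bit e′ ℤ.- bit e))) ⟩
    ∣ + p ℤ.* (bit e′ ℤ.- bit e) ∣       ≡⟨ ℤₚ.abs-* (+ p) (bit e′ ℤ.- bit e) ⟩
    p * ∣ bit e′ ℤ.- bit e ∣             ∎
  0<q+p : 0 < q + p
  0<q+p = ℕₚ.<-≤-trans 0<q (ℕₚ.m≤m+n q p)
  equal : (q + p) * ∣ i ℤ.- j ∣ ≡ p * 0 → i ≡ j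
  equal eq′ with ℕₚ.m*n≡0⇒m≡0∨n≡0 (q + p) (trans eq′ (ℕₚ.*-zeroʳ p))
  ... | inj₁ q+p≡0 = ⊥-elim (ℕₚ.<⇒≢ 0<q+p (sym q+p≡0))
  ... | inj₂ ∣i-j∣≡0 = ℤₚ.i-j≡0⇒i≡j i j (ℤₚ.∣i∣≡0⇒i≡0 ∣i-j∣≡0)
  unequal : ∀ k → (q + p) * k ≡ p * 1 → ⊥
  unequal zero    eq′ = ℕₚ.<⇒≢ 0<p (sym (trans (sym (ℕₚ.*-identityʳ p)) (trans (sym eq′) (ℕₚ.*-zeroʳ (q + p)))))
  unequal (suc k) eq′ = ℕₚ.<-irrefl refl (ℕₚ.<-≤-trans (ℕₚ.m<n+m p 0<q)
    (ℕₚ.≤-trans (ℕₚ.m≤m*n (q + p) (suc k)) (ℕₚ.≤-reflexive (trans eq′ (ℕₚ.*-identityʳ p)))))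
  conclude : ∀ e e′ → (q + p) * ∣ i ℤ.- j ∣ ≡ p * ∣ bit e′ ℤ.- bit e ∣ → i ≡ j × e ≡ e′
  conclude true  true  eq′ = equal eq′ , refl
  conclude false false eq′ = equal eq′ , refl
  conclude true  false eq′ = ⊥-elim (unequal _ eq′)
  conclude false true  eq′ = ⊥-elim (unequal _ eq′)

-- Twice the coarse coordinate plus the bit is bracketed so that the second summand is the distance
-- a node has to move when its cell is split.
record Halves (ax : Axis) (p p′ : Point) (h : Bool) : Set where
  field
    along-half : along ax p ≡ along ax p′ ℤ.+ (along ax p′ ℤ.+ bit h)
    across-≡   : across ax p ≡ across ax p′

open Halves

halves-unique : ∀ i j e e′ → i ℤ.+ (i ℤ.+ bit e) ≡ j ℤ.+ (j ℤ.+ bit e′) → i ≡ j × e ≡ e′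
halves-unique i j e e′ eq = scaled-separated 1 1 (s≤s z≤n) (s≤s z≤n) i j e e′
  (trans (unit i (bit e)) (trans eq (sym (unit j (bit e′)))))
  where
  unit : ∀ i b → 1ℤ ℤ.* i ℤ.+ 1ℤ ℤ.* (i ℤ.+ b) ≡ i ℤ.+ (i ℤ.+ b)
  unit = solve-∀

-- What a fine edge between different cells reveals: a step along the axis leaves the rear cell
-- through its upper half and enters the front cell through its lower half, while a step across
-- stays in the same half. These bits tell which halves are occupied.
data Linked (ax : Axis) (p : Point) (h : Bool) (q : Point) (h′ : Bool) : Set where
  ahead  : h ≡ true → h′ ≡ false → along ax q ≡ along ax p ℤ.+ 1ℤ → across ax p ≡ across ax q →
           Linked ax p h q h′
  behind : h ≡ false → h′ ≡ true → along ax p ≡ along ax q ℤ.+ 1ℤ → across ax p ≡ across ax q →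
           Linked ax p h q h′
  beside : h ≡ h′ → along ax p ≡ along ax q → ∣ across ax p ℤ.- across ax q ∣ ≡ 1 → Linked ax p h q h′

linked⇒neighbours : ∀ {ax p h q h′} → Linked ax p h q h′ → Neighbours ax p q
linked⇒neighbours (ahead  _ _ a c) = ahead a c
linked⇒neighbours (behind _ _ a c) = behind a c
linked⇒neighbours (beside _ a c)   = beside a c

-- Binary increment: a last bit `false` absorbs the one without leaving the cell, a last bit `true`
-- carries into the next cell.
successor-halves : ∀ i j h h′ → j ℤ.+ (j ℤ.+ bit h′) ≡ (i ℤ.+ (i ℤ.+ bit h)) ℤ.+ 1ℤ →
  (h ≡ false × h′ ≡ true × i ≡ j) ⊎ (h ≡ true × h′ ≡ false × j ≡ i ℤ.+ 1ℤ)
successor-halves i j false h′ eq with halves-unique j i h′ true (trans eq (lemma i))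
  where
  lemma : ∀ i → (i ℤ.+ (i ℤ.+ 0ℤ)) ℤ.+ 1ℤ ≡ i ℤ.+ (i ℤ.+ 1ℤ)
  lemma = solve-∀
... | j≡i , h′≡ = inj₁ (refl , h′≡ , sym j≡i)
successor-halves i j true h′ eq with halves-unique j (i ℤ.+ 1ℤ) h′ false (trans eq (lemma i))
  where
  lemma : ∀ i → (i ℤ.+ (i ℤ.+ 1ℤ)) ℤ.+ 1ℤ ≡ (i ℤ.+ 1ℤ) ℤ.+ ((i ℤ.+ 1ℤ) ℤ.+ 0ℤ)
  lemma = solve-∀
... | j≡ , h′≡ = inj₂ (refl , h′≡ , j≡)

neighbours-halves : ∀ {ax p q p′ q′ h h′} → Halves ax p p′ h → Halves ax q q′ h′ → Neighbours ax p q →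
  p′ ≡ q′ ⊎ Linked ax p′ h q′ h′
neighbours-halves {ax} {p′ = p′} {q′} {h} {h′} P Q (ahead a c)
  with successor-halves (along ax p′) (along ax q′) h h′
         (trans (sym (along-half Q)) (trans a (cong (ℤ._+ 1ℤ) (along-half P))))
     | trans (sym (across-≡ P)) (trans c (across-≡ Q))
... | inj₁ (_ , _ , a′)  | c′ = inj₁ (point-≡ ax a′ c′)
... | inj₂ (x , y , a′) | c′ = inj₂ (ahead x y a′ c′)
neighbours-halves {ax} {p′ = p′} {q′} {h} {h′} P Q (behind a c)
  with successor-halves (along ax q′) (along ax p′) h′ h
         (trans (sym (along-half P)) (trans a (cong (ℤ._+ 1ℤ) (along-half Q))))
     | trans (sym (across-≡ P)) (trans c (across-≡ Q))
... | inj₁ (_ , _ , a′)  | c′ = inj₁ (point-≡ ax (sym a′) c′)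
... | inj₂ (x , y , a′) | c′ = inj₂ (behind y x a′ c′)
neighbours-halves {ax} {p′ = p′} {q′} {h} {h′} P Q (beside a c)
  with halves-unique (along ax p′) (along ax q′) h h′ (trans (sym (along-half P)) (trans a (along-half Q)))
... | a′ , h≡h′ = inj₂ (beside h≡h′ a′ (subst₂ (λ i j → ∣ i ℤ.- j ∣ ≡ 1) (across-≡ P) (across-≡ Q) c))

-- The time step that undoes one halving.

≡true⇒T : ∀ {b} → b ≡ true → T b
≡true⇒T refl = _

push-≡-bit : ∀ {n} (S : Shape n) (ops : Operations n) {u v} b →
  (T b → Motion.Reattached S ops u v) → (Motion.Reattached S ops u v → T b) →
  Motion.push S ops u v ≡ bit b
push-≡-bit S ops true  to _    = push-yes S ops (to _)
push-≡-bit S ops false _  from = push-no S ops from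

i≢i+1 : ∀ i → i ≢ i ℤ.+ 1ℤ
i≢i+1 i eq with trans (sym (ℤₚ.+-inverseʳ i)) (trans (cong (λ j → j ℤ.- i) eq) (i+1-i≡1 i))
... | ()

i≢i+1+1 : ∀ i → i ≢ (i ℤ.+ 1ℤ) ℤ.+ 1ℤ
i≢i+1+1 i eq with trans (sym (ℤₚ.+-inverseʳ i)) (trans (cong (λ j → j ℤ.- i) eq) (lemma i))
  where
  lemma : ∀ i → (i ℤ.+ 1ℤ) ℤ.+ 1ℤ ℤ.- i ≡ + 2
  lemma = solve-∀
... | ()

-- Unlike the ordinary map of walks, it lets an edge collapse to a point, as happens to a fine edge
-- inside a single cell.
starMap : ∀ {A B : Set} {R : A → A → Set} {Q : B → B → Set} (f : A → B) →
  (∀ {x y} → R x y → f x ≡ f y ⊎ Q (f x) (f y)) → ∀ {x y} → Star R x y → Star Q (f x) (f y)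
starMap f g ε = ε
starMap {Q = Q} f g (_◅_ {k = z} r rs) with g r
... | inj₁ fx≡fy = subst (λ w → Star Q w (f z)) (sym fx≡fy) (starMap f g rs)
... | inj₂ q     = q ◅ starMap f g rs

-- `K` is the coarse shape as already grown, with all adjacencies present, and `F` the finer shape
-- to be reached. The `offset` compensates for the translation that the process has accumulated.
module Refinement {n m} (ax : Axis) (F : Shape n) (K : Shape m)
    (full : ∀ {u v} → Adjacent (pos K u) (pos K v) → Edge K u v)
    (cell : Fin n → Fin m) (upper : Fin n → Bool) (surjective : ∀ u → ∃ λ a → cell a ≡ u)
    (offset : Point) (halves : ∀ a → Halves ax (pos F a ⊕ offset) (pos K (cell a)) (upper a))
    (u₀ : Fin m) where

  occupant? : ∀ u h → Dec (∃ λ a → cell a ≡ u × upper a ≡ h)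
  occupant? u h = any? λ a → (cell a Fin.≟ u) ×-dec (upper a Boolₚ.≟ h)

  occupied : Fin m → Bool → Bool
  occupied u h = ⌊ occupant? u h ⌋

  occupied-cell : ∀ a → occupied (cell a) (upper a) ≡ true
  occupied-cell a with occupant? (cell a) (upper a)
  ... | yes _ = refl
  ... | no ¬p = ⊥-elim (¬p (a , refl , refl))

  occupant : ∀ {u h} → occupied u h ≡ true → ∃ λ a → cell a ≡ u × upper a ≡ h
  occupant {u} {h} eq = toWitness {a? = occupant? u h} (≡true⇒T eq)

  ops : Operations m
  ops = record
    { direction = forward ax
    ; grows     = λ u → occupied u false ∧ occupied u true
    -- `Reattached` itself checks that the first node grows and that the direction is perpendicular,
    -- so only the neighbour needs inspection.
    ; handover  = λ _ v → not (occupied v false)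
    }

  open Motion K ops using (Reattached; push; contribution)

  row : Fin m → ℤ
  row u = along ax (pos K u)

  -- Whether the old node of the cell u ends in the upper of the two rows that u splits into.
  lifted : Fin m → Bool
  lifted u = not (occupied u false)

  φ : Fin m → ℤ
  φ u = row u ℤ.+ bit (lifted u)

  push-ahead : ∀ {u v} → row v ≡ row u ℤ.+ 1ℤ → across ax (pos K u) ≡ across ax (pos K v) →
    push u v ≡ bit (occupied u false ∧ occupied u true)
  push-ahead {u} {v} a c = push-≡-bit K ops _
    (λ g → g , inj₁ (point-≡ ax (trans a (sym (along-next ax (pos K u))))
                                (trans (sym c) (sym (across-next ax (pos K u))))))
    proj₁

  -- An operation on `v` can reattach only a neighbour one unit ahead or on the same row, and `u`
  -- lies one row behind.
  push-behind : ∀ {u v} → row v ≡ row u ℤ.+ 1ℤ → push v u ≡ 0ℤ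
  push-behind {u} {v} a = push-no K ops ¬reattached
    where
    ¬reattached : ¬ Reattached v u
    ¬reattached (_ , inj₁ eq) = i≢i+1+1 (row u)
      (trans (cong (along ax) eq) (trans (along-next ax (pos K v)) (cong (ℤ._+ 1ℤ) a)))
    ¬reattached (_ , inj₂ (eq , _)) = i≢i+1 (row u)
      (trans (ℤₚ.i-j≡0⇒i≡j (row u) (row v) (trans (sym (difference-forward ax (pos K u) (pos K v))) eq)) a)

  push-beside : ∀ {u v} → row u ≡ row v →
    push u v ≡ bit ((occupied u false ∧ occupied u true) ∧ lifted v)
  push-beside {u} {v} a = push-≡-bit K ops _
    (λ t → let g , h = Equivalence.to (T-∧ {occupied u false ∧ occupied u true}) t in
      g , inj₂ (trans (difference-forward ax (pos K v) (pos K u)) (ℤₚ.i≡j⇒i-j≡0 (sym a)) , h))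
    λ { (g , inj₁ eq) → ⊥-elim (i≢i+1 (row u)
          (trans a (trans (cong (along ax) eq) (along-next ax (pos K u)))))
      ; (g , inj₂ (_ , h)) → Equivalence.from (T-∧ {occupied u false ∧ occupied u true}) (g , h) }

  Compatible : Fin m → Fin m → Set
  Compatible u v = contribution u v ≡ φ v ℤ.- φ u

  compatible-sym : ∀ {u v} → Compatible u v → Compatible v u
  compatible-sym {u} {v} c = trans (flip (push v u) (push u v)) (trans (cong ℤ.-_ c) (sym (flip (φ u) (φ v))))
    where
    flip : ∀ i j → i ℤ.- j ≡ ℤ.- (j ℤ.- i)
    flip = solve-∀

  -- Here `φ v` is `row u + 1`, so the difference is `1` if `u` has a lower node and `0` otherwise.
  -- As the upper half of `u` is occupied, having a lower node is the same as growing, that is, as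
  -- pushing `v`.
  compatible-ahead : ∀ {u v} → occupied u true ≡ true → occupied v false ≡ true →
    row v ≡ row u ℤ.+ 1ℤ → across ax (pos K u) ≡ across ax (pos K v) → Compatible u v
  compatible-ahead {u} {v} u↑ v↓ a c = trans
    (cong₂ ℤ._-_ (trans (push-ahead a c) (cong (λ b → bit (occupied u false ∧ b)) u↑)) (push-behind a))
    (trans (evaluate (row u) (occupied u false))
           (sym (cong₂ (λ i b → i ℤ.+ bit (not b) ℤ.- φ u) a v↓)))
    where
    evaluate : ∀ i b → bit (b ∧ true) ℤ.- 0ℤ ≡ i ℤ.+ 1ℤ ℤ.+ 0ℤ ℤ.- (i ℤ.+ bit (not b))
    evaluate i true  = lemma i
      where
      lemma : ∀ i → 1ℤ ≡ i ℤ.+ 1ℤ ℤ.+ 0ℤ ℤ.- (i ℤ.+ 0ℤ)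
      lemma = solve-∀
    evaluate i false = lemma i
      where
      lemma : ∀ i → 0ℤ ≡ i ℤ.+ 1ℤ ℤ.+ 0ℤ ℤ.- (i ℤ.+ 1ℤ)
      lemma = solve-∀

  -- If both lower halves are occupied, nothing is handed over and neither cell is lifted. If both
  -- upper halves are, a handover occurs only when one cell has a lower node and the other has none,
  -- which is also when the lifts differ.
  compatible-beside : ∀ {u v} h → occupied u h ≡ true → occupied v h ≡ true → row u ≡ row v → Compatible u v
  compatible-beside {u} {v} h u-h v-h a = trans
    (cong₂ ℤ._-_ (push-beside a) (push-beside (sym a)))
    (trans (evaluate h (occupied u) (occupied v) u-h v-h)
      (trans (sym (cancel (row u) (bit (lifted v)) (bit (lifted u))))
        (cong (λ i → i ℤ.+ bit (lifted v) ℤ.- φ u) a)))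
    where
    cancel : ∀ i x y → i ℤ.+ x ℤ.- (i ℤ.+ y) ≡ x ℤ.- y
    cancel = solve-∀
    evaluate : ∀ h (o o′ : Bool → Bool) → o h ≡ true → o′ h ≡ true →
      bit ((o false ∧ o true) ∧ not (o′ false)) ℤ.- bit ((o′ false ∧ o′ true) ∧ not (o false))
        ≡ bit (not (o′ false)) ℤ.- bit (not (o false))
    evaluate false o o′ p q rewrite p | q | Boolₚ.∧-zeroʳ (o true) | Boolₚ.∧-zeroʳ (o′ true) = refl
    evaluate true  o o′ p q rewrite p | q with o false | o′ false
    ... | true  | true  = refl
    ... | true  | false = refl
    ... | false | true  = refl
    ... | false | false = refl

  linked⇒compatible : ∀ {a b} → Linked ax (pos K (cell a)) (upper a) (pos K (cell b)) (upper b) →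
    Compatible (cell a) (cell b)
  linked⇒compatible {a} {b} (ahead h h′ r c) = compatible-ahead
    (subst (λ x → occupied (cell a) x ≡ true) h (occupied-cell a))
    (subst (λ x → occupied (cell b) x ≡ true) h′ (occupied-cell b)) r c
  linked⇒compatible {a} {b} (behind h h′ r c) = compatible-sym (compatible-ahead
    (subst (λ x → occupied (cell b) x ≡ true) h′ (occupied-cell b))
    (subst (λ x → occupied (cell a) x ≡ true) h (occupied-cell a)) r (sym c))
  linked⇒compatible {a} {b} (beside h r _) = compatible-beside (upper a) (occupied-cell a)
    (subst (λ x → occupied (cell b) x ≡ true) (sym h) (occupied-cell b)) r

  -- Every compatible adjacency is kept, whether or not it comes from an edge of `F`. The relation
  -- is thus decidable by comparing integers and supplies the hypothesis of `PotentialGrowth` by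
  -- projection; the edges coming from `F` ensure connectedness.
  Retained : Fin m → Fin m → Set
  Retained u v = Adjacent (pos K u) (pos K v) × Compatible u v

  edge⇒retained : ∀ {a b} → Edge F a b → cell a ≡ cell b ⊎ Retained (cell a) (cell b)
  edge⇒retained {a} {b} e with neighbours-halves (halves a) (halves b)
    (adjacent⇒neighbours ax _ _ (trans (manhattan-translate (pos F a) (pos F b) offset) (edge-adjacent F e)))
  ... | inj₁ eq = inj₁ (pos-injective K eq)
  ... | inj₂ l  = inj₂ (neighbours⇒adjacent ax _ _ (linked⇒neighbours l) , linked⇒compatible l)

  retained-connected : ∀ u v → Star Retained u v
  retained-connected u v with surjective u | surjective v
  ... | a , refl | b , refl = starMap cell edge⇒retained (connected F a b)

  pruned : Shape m
  pruned = record
    { nonempty      = nonempty K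
    ; pos           = pos K
    ; pos-injective = pos-injective K
    ; Edge          = Retained
    ; edge?         = λ u v → (manhattan (pos K u) (pos K v) ℕ.≟ 1) ×-dec (contribution u v ℤ.≟ φ v ℤ.- φ u)
    ; edge-sym      = λ {u} {v} (a , c) → adjacent-sym {pos K u} {pos K v} a , compatible-sym c
    ; edge-adjacent = proj₁
    ; connected     = retained-connected
    }

  module Potential = PotentialGrowth pruned ops u₀ φ proj₂
  open Potential using (tree; displacement-potential)
  open Motion pruned ops using (shift; final; scaledPosition; NoNodeCollision; d)

  cellOf : Node ops → Fin m
  cellOf (old u)   = u
  cellOf (new u _) = u

  upperOf : Node ops → Bool
  upperOf (old u)   = lifted u
  upperOf (new _ _) = true

  grows⇒¬lifted : ∀ u → T (grows ops u) → lifted u ≡ false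
  grows⇒¬lifted u g with occupied u false
  ... | true = refl

  -- A cell that grows has a lower node, so its old node takes the lower half and cannot be confused
  -- with the new one.
  node-≡ : ∀ x y → cellOf x ≡ cellOf y → upperOf x ≡ upperOf y → x ≡ y
  node-≡ (old u)   (old _)   refl _ = refl
  node-≡ (new u g) (new _ h) refl _ = cong (new u) (T-irrelevant g h)
  node-≡ (old u)   (new _ g) refl e with trans (sym e) (grows⇒¬lifted u g)
  ... | ()
  node-≡ (new u g) (old _)   refl e with trans e (grows⇒¬lifted u g)
  ... | ()

  -- By surjectivity of `cell` no cell is empty, so a cell without a lower node has an upper one.
  lifted-occupied : ∀ u → occupied u (lifted u) ≡ true
  lifted-occupied u with occupied u false in eq
  ... | true  = eq
  ... | false with surjective u
  ...   | a , refl with upper a | occupied-cell a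
  ...     | true  | p = p
  ...     | false | p with () ← trans (sym p) eq

  upperOf-occupied : ∀ x → occupied (cellOf x) (upperOf x) ≡ true
  upperOf-occupied (old u)   = lifted-occupied u
  upperOf-occupied (new u g) with occupied u false | occupied u true
  ... | true | true = refl

  occupant-unique : ∀ a b → cell a ≡ cell b → upper a ≡ upper b → a ≡ b
  occupant-unique a b c≡ u≡ = pos-injective F (⊕-cancelʳ offset (point-≡ ax
    (trans (along-half (halves a))
      (trans (cong₂ (λ u h → row u ℤ.+ (row u ℤ.+ bit h)) c≡ u≡) (sym (along-half (halves b)))))
    (trans (across-≡ (halves a)) (trans (cong (λ u → across ax (pos K u)) c≡) (sym (across-≡ (halves b)))))))

  nodeFor : ∀ u h → occupied u h ≡ true → ∃ λ x → cellOf x ≡ u × upperOf x ≡ h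
  nodeFor u false o = old u , refl , cong not o
  nodeFor u true  o with occupied u false in eq
  ... | true  = new u (≡true⇒T (cong₂ _∧_ eq o)) , refl , refl
  ... | false = old u , refl , cong not eq

  -- Both sides are coordinatised by the occupied pairs of a cell and a half.
  nodes : Node ops ↔ Fin n
  nodes = mk↔ₛ′ to from to-from from-to
    where
    to : Node ops → Fin n
    to x = proj₁ (occupant (upperOf-occupied x))
    to-spec : ∀ x → cell (to x) ≡ cellOf x × upper (to x) ≡ upperOf x
    to-spec x = proj₂ (occupant (upperOf-occupied x))
    from : Fin n → Node ops
    from a = proj₁ (nodeFor _ _ (occupied-cell a))
    from-spec : ∀ a → cellOf (from a) ≡ cell a × upperOf (from a) ≡ upper a
    from-spec a = proj₂ (nodeFor _ _ (occupied-cell a))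
    to-from : ∀ a → to (from a) ≡ a
    to-from a = occupant-unique _ _
      (trans (proj₁ (to-spec (from a))) (proj₁ (from-spec a)))
      (trans (proj₂ (to-spec (from a))) (proj₂ (from-spec a)))
    from-to : ∀ x → from (to x) ≡ x
    from-to x = node-≡ _ _
      (trans (proj₁ (from-spec (to x))) (proj₁ (to-spec x)))
      (trans (proj₂ (from-spec (to x))) (proj₂ (to-spec x)))

  open Inverse nodes using (from)

  cellOf-from : ∀ a → cellOf (from a) ≡ cell a
  cellOf-from a = proj₁ (proj₂ (nodeFor _ _ (occupied-cell a)))

  upperOf-from : ∀ a → upperOf (from a) ≡ upper a
  upperOf-from a = proj₂ (proj₂ (nodeFor _ _ (occupied-cell a)))

  start-≡ : ∀ x → Motion.start pruned ops tree x ≡ pos K (cellOf x)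
  start-≡ (old _)   = refl
  start-≡ (new _ _) = refl

  shift-≡ : ∀ x → shift tree x ≡ row (cellOf x) ℤ.+ bit (upperOf x) ℤ.- φ u₀
  shift-≡ (old u)   = displacement-potential u
  shift-≡ (new u g) = trans (cong (ℤ._+ 1ℤ) (displacement-potential u))
    (trans (cong (λ b → row u ℤ.+ bit b ℤ.- φ u₀ ℤ.+ 1ℤ) (grows⇒¬lifted u g)) (lemma (row u) (φ u₀)))
    where
    lemma : ∀ i f → i ℤ.+ 0ℤ ℤ.- f ℤ.+ 1ℤ ≡ i ℤ.+ 1ℤ ℤ.- f
    lemma = solve-∀

  -- Splits off the term in `φ u₀`, which is common to all nodes and cancels, leaving the form
  -- treated by `scaled-separated`.
  along-scaled : ∀ p q x → along ax (scaledPosition tree p q x) ≡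
    (+ q ℤ.* row (cellOf x) ℤ.+ + p ℤ.* (row (cellOf x) ℤ.+ bit (upperOf x))) ℤ.+ ℤ.- (+ p ℤ.* φ u₀)
  along-scaled p q x = trans
    (along-forward ax (+ q • Motion.start pruned ops tree x) (+ p ℤ.* shift tree x))
    (trans (cong₂ ℤ._+_
        (trans (along-• ax (+ q) (Motion.start pruned ops tree x)) (cong (λ z → + q ℤ.* along ax z) (start-≡ x)))
        (cong (λ s → + p ℤ.* s) (shift-≡ x)))
      (lemma (+ p) (+ q) (row (cellOf x)) (bit (upperOf x)) (φ u₀)))
    where
    lemma : ∀ p q i b f → q ℤ.* i ℤ.+ p ℤ.* (i ℤ.+ b ℤ.- f) ≡ (q ℤ.* i ℤ.+ p ℤ.* (i ℤ.+ b)) ℤ.+ ℤ.- (p ℤ.* f)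
    lemma = solve-∀

  across-scaled : ∀ p q x → across ax (scaledPosition tree p q x) ≡ + q ℤ.* across ax (pos K (cellOf x))
  across-scaled p q x = trans
    (across-forward ax (+ q • Motion.start pruned ops tree x) (+ p ℤ.* shift tree x))
    (trans (across-• ax (+ q) (Motion.start pruned ops tree x)) (cong (λ z → + q ℤ.* across ax z) (start-≡ x)))

  noCollision : NoNodeCollision tree
  noCollision p@(suc _) q@(suc _) 0<p p≤q {x} {y} eq =
    node-≡ x y (pos-injective K (point-≡ ax (proj₁ separated) sameAcross)) (proj₂ separated)
    where
    separated : row (cellOf x) ≡ row (cellOf y) × upperOf x ≡ upperOf y
    separated = scaled-separated p q 0<p (s≤s z≤n) _ _ _ _
      (+-cancelʳ (ℤ.- (+ p ℤ.* φ u₀)) _ _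
        (trans (sym (along-scaled p q x)) (trans (cong (along ax) eq) (along-scaled p q y))))
    -- Nothing moves across the axis, and `q` is positive because `0 < p ≤ q`, so it can be
    -- cancelled.
    sameAcross : across ax (pos K (cellOf x)) ≡ across ax (pos K (cellOf y))
    sameAcross = ℤₚ.*-cancelˡ-≡ (+ q) _ _
      (trans (sym (across-scaled p q x)) (trans (cong (across ax) eq) (across-scaled p q y)))

  open Potential.Result nodes noCollision public using (shape; growth)

  anchor′ : Fin n
  anchor′ = Inverse.to nodes (old u₀)

  timeStep : TimeStep K u₀ shape anchor′
  timeStep = record
    { Sᵈ       = pruned
    ; deletion = record { positions = λ _ → refl ; edges = λ e → full (proj₁ e) }
    ; growth   = growth
    }

  -- Each node of row `i` moves by `i` or `i + 1` less `φ u₀`, which doubles the row and adds the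
  -- bit. The subtraction, which keeps the anchor stationary, shifts the whole result.
  shape-pos : ∀ a → pos shape a ≡ pos F a ⊕ (offset ⊕ (ℤ.- φ u₀) • ⟦ forward ax ⟧)
  shape-pos a = point-≡ ax
    (begin
      along ax (final tree x)
        ≡⟨ along-forward ax (Motion.start pruned ops tree x) (shift tree x) ⟩
      along ax (Motion.start pruned ops tree x) ℤ.+ shift tree x
        ≡⟨ cong₂ ℤ._+_ (cong (along ax) (start-≡ x)) (shift-≡ x) ⟩
      row (cellOf x) ℤ.+ (row (cellOf x) ℤ.+ bit (upperOf x) ℤ.- φ u₀)
        ≡⟨ cong₂ (λ u h → row u ℤ.+ (row u ℤ.+ bit h ℤ.- φ u₀)) (cellOf-from a) (upperOf-from a) ⟩
      row (cell a) ℤ.+ (row (cell a) ℤ.+ bit (upper a) ℤ.- φ u₀)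
        ≡⟨ assoc (row (cell a)) (bit (upper a)) (φ u₀) ⟩
      (row (cell a) ℤ.+ (row (cell a) ℤ.+ bit (upper a))) ℤ.- φ u₀
        ≡⟨ cong (λ i → i ℤ.- φ u₀) (along-half (halves a)) ⟨
      along ax (pos F a ⊕ offset) ℤ.- φ u₀
        ≡⟨ along-forward ax (pos F a ⊕ offset) (ℤ.- φ u₀) ⟨
      along ax (pos F a ⊕ offset ⊕ (ℤ.- φ u₀) • ⟦ forward ax ⟧)
        ≡⟨ cong (along ax) (⊕-assoc (pos F a) offset _) ⟩
      along ax (pos F a ⊕ (offset ⊕ (ℤ.- φ u₀) • ⟦ forward ax ⟧)) ∎)
    (begin
      across ax (final tree x)
        ≡⟨ across-forward ax (Motion.start pruned ops tree x) (shift tree x) ⟩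
      across ax (Motion.start pruned ops tree x)
        ≡⟨ cong (across ax) (trans (start-≡ x) (cong (pos K) (cellOf-from a))) ⟩
      across ax (pos K (cell a))
        ≡⟨ across-≡ (halves a) ⟨
      across ax (pos F a ⊕ offset)
        ≡⟨ across-forward ax (pos F a ⊕ offset) (ℤ.- φ u₀) ⟨
      across ax (pos F a ⊕ offset ⊕ (ℤ.- φ u₀) • ⟦ forward ax ⟧)
        ≡⟨ cong (across ax) (⊕-assoc (pos F a) offset _) ⟩
      across ax (pos F a ⊕ (offset ⊕ (ℤ.- φ u₀) • ⟦ forward ax ⟧)) ∎)
    where
    open ≡-Reasoning
    x = from a
    assoc : ∀ i b f → i ℤ.+ (i ℤ.+ b ℤ.- f) ≡ (i ℤ.+ (i ℤ.+ b)) ℤ.- f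
    assoc = solve-∀

-- Coarsening a shape by merging pairs of lines.

lookup-injective : ∀ {A : Set} {xs : List A} → Unique xs → Injective _≡_ _≡_ (lookup xs)
lookup-injective (_   ∷ _)  {zero}  {zero}  _  = refl
lookup-injective (x∉ ∷ _)  {zero}  {suc j} eq = ⊥-elim (All.lookup x∉ (∈-lookup j) eq)
lookup-injective (x∉ ∷ _)  {suc i} {zero}  eq = ⊥-elim (All.lookup x∉ (∈-lookup i) (sym eq))
lookup-injective (_   ∷ xs!) {suc i} {suc j} eq = cong suc (lookup-injective xs! eq)

-- Euclidean division: the remainder is `0` or `1` for negative coordinates as well.
half : ℤ → ℤ
half z = z ℤ./ℕ 2

odd : ℤ → Bool
odd z = (z ℤ.%ℕ 2) ℕ.≡ᵇ 1

half-odd : ∀ z → z ≡ half z ℤ.+ (half z ℤ.+ bit (odd z))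
half-odd z = trans (a≡a%ℕn+[a/ℕn]*n z 2) (regroup (z ℤ.%ℕ 2) (n%ℕd<d z 2))
  where
  even-case : ∀ h → 0ℤ ℤ.+ h ℤ.* + 2 ≡ h ℤ.+ (h ℤ.+ 0ℤ)
  even-case = solve-∀
  odd-case : ∀ h → 1ℤ ℤ.+ h ℤ.* + 2 ≡ h ℤ.+ (h ℤ.+ 1ℤ)
  odd-case = solve-∀
  regroup : ∀ r → r < 2 → + r ℤ.+ half z ℤ.* + 2 ≡ half z ℤ.+ (half z ℤ.+ bit (r ℕ.≡ᵇ 1))
  regroup 0 _ = even-case (half z)
  regroup 1 _ = odd-case (half z)
  regroup (suc (suc _)) (s≤s (s≤s ()))

halve : Axis → Point → Point
halve vertical   (x , y) = x , half y
halve horizontal (x , y) = half x , y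

along-halve : ∀ ax p → along ax (halve ax p) ≡ half (along ax p)
along-halve vertical   _ = refl
along-halve horizontal _ = refl

halve-halves : ∀ ax p → Halves ax p (halve ax p) (odd (along ax p))
halve-halves vertical   (x , y) = record { along-half = half-odd y ; across-≡ = refl }
halve-halves horizontal (x , y) = record { along-half = half-odd x ; across-≡ = refl }

-- A translation of the coarse point corresponds to one of the fine point whose component along the
-- axis is doubled.
halves-translate : ∀ ax {p p′ h} o → Halves ax p p′ h →
  Halves ax (p ⊕ (o ⊕ along ax o • ⟦ forward ax ⟧)) (p′ ⊕ o) h
halves-translate ax {p} {p′} {h} o P = record
  { along-half = begin
      along ax (p ⊕ o′)                         ≡⟨ along-⊕ ax p o′ ⟩
      along ax p ℤ.+ along ax o′                ≡⟨ cong₂ ℤ._+_ (along-half P) (along-forward ax o (along ax o)) ⟩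
      (i ℤ.+ (i ℤ.+ bit h)) ℤ.+ (j ℤ.+ j)       ≡⟨ regroup i j (bit h) ⟩
      (i ℤ.+ j) ℤ.+ ((i ℤ.+ j) ℤ.+ bit h)       ≡⟨ cong (λ k → k ℤ.+ (k ℤ.+ bit h)) (along-⊕ ax p′ o) ⟨
      along ax (p′ ⊕ o) ℤ.+ (along ax (p′ ⊕ o) ℤ.+ bit h) ∎
  ; across-≡ = begin
      across ax (p ⊕ o′)               ≡⟨ across-⊕ ax p o′ ⟩
      across ax p ℤ.+ across ax o′     ≡⟨ cong₂ ℤ._+_ (across-≡ P) (across-forward ax o (along ax o)) ⟩
      across ax p′ ℤ.+ across ax o     ≡⟨ across-⊕ ax p′ o ⟨
      across ax (p′ ⊕ o)               ∎
  }
  where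
  open ≡-Reasoning
  o′ = o ⊕ along ax o • ⟦ forward ax ⟧
  i  = along ax p′
  j  = along ax o
  regroup : ∀ i j b → (i ℤ.+ (i ℤ.+ b)) ℤ.+ (j ℤ.+ j) ≡ (i ℤ.+ j) ℤ.+ ((i ℤ.+ j) ℤ.+ b)
  regroup = solve-∀

-- The edges of `F` are deliberately ignored: the closure after each step makes all adjacencies
-- edges, so only positions are tracked until the final deletion.
record Grown (t : ℕ) {n} (F : Shape n) : Set₁ where
  field
    {shape}   : Shape n
    {anchor}  : Fin n
    process   : Process singleNode zero t shape anchor
    full      : ∀ {u v} → Adjacent (pos shape u) (pos shape v) → Edge shape u v
    offset    : Point
    positions : ∀ u → pos shape u ≡ pos F u ⊕ offset

module Coarsening {n} (ax : Axis) (F : Shape n) where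

  points : List Point
  points = deduplicate _≟ᵖ_ (map (halve ax) (tabulate (pos F)))

  halve∈points : ∀ a → halve ax (pos F a) ∈ points
  halve∈points a = ∈-deduplicate⁺ _≟ᵖ_ (∈-map⁺ (halve ax) (∈-tabulate⁺ {f = pos F} a))

  cell : Fin n → Fin (length points)
  cell a = index (halve∈points a)

  lookup-cell : ∀ a → lookup points (cell a) ≡ halve ax (pos F a)
  lookup-cell a = sym (lookup-index (halve∈points a))

  lookup-points-injective : Injective _≡_ _≡_ (lookup points)
  lookup-points-injective = lookup-injective (deduplicate-! _≟ᵖ_ (map (halve ax) (tabulate (pos F))))

  surjective : ∀ u → ∃ λ a → cell a ≡ u
  surjective u with ∈-map⁻ (halve ax) (∈-deduplicate⁻ _≟ᵖ_ (map (halve ax) (tabulate (pos F))) (∈-lookup u))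
  ... | p , p∈ , eq with ∈-tabulate⁻ {f = pos F} p∈
  ...   | a , refl = a , lookup-points-injective (trans (lookup-cell a) (sym eq))

  upper : Fin n → Bool
  upper a = odd (along ax (pos F a))

  halves : ∀ a → Halves ax (pos F a) (lookup points (cell a)) (upper a)
  halves a = subst (λ p → Halves ax (pos F a) p (upper a)) (sym (lookup-cell a)) (halve-halves ax (pos F a))

  edge⇒adjacent : ∀ {a b} → Edge F a b →
    cell a ≡ cell b ⊎ Adjacent (lookup points (cell a)) (lookup points (cell b))
  edge⇒adjacent {a} {b} e
    with neighbours-halves (halves a) (halves b) (adjacent⇒neighbours ax _ _ (edge-adjacent F e))
  ... | inj₁ eq = inj₁ (lookup-points-injective eq)
  ... | inj₂ l  = inj₂ (neighbours⇒adjacent ax _ _ (linked⇒neighbours l))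

  coarse : Shape (length points)
  coarse = record
    { nonempty      = inhabited (nonempty F) cell
    ; pos           = lookup points
    ; pos-injective = lookup-points-injective
    ; Edge          = λ u v → Adjacent (lookup points u) (lookup points v)
    ; edge?         = λ u v → manhattan (lookup points u) (lookup points v) ℕ.≟ 1
    ; edge-sym      = λ {u} {v} → adjacent-sym {lookup points u} {lookup points v}
    ; edge-adjacent = id
    ; connected     = coarse-connected
    }
    where
    inhabited : ∀ {k l} → NonZero k → (Fin k → Fin l) → NonZero l
    inhabited {suc _} {suc _} _ _ = _
    inhabited {suc _} {zero}  _ f with () ← f zero
    coarse-connected : ∀ u v → Star (λ u v → Adjacent (lookup points u) (lookup points v)) u v
    coarse-connected u v with surjective u | surjective v
    ... | a , refl | b , refl = starMap cell edge⇒adjacent (connected F a b)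

  refine : ∀ {t} → Grown t coarse → Grown (suc t) F
  refine G = record
    { process   = next process R.timeStep
    -- The process ends in an adjacency closure, whose edge relation is adjacency by definition.
    ; full      = id
    ; offset    = _
    ; positions = R.shape-pos
    }
    where
    open Grown G
    module R = Refinement ax F shape full cell upper surjective (offset ⊕ along ax offset • ⟦ forward ax ⟧)
      (λ a → subst (λ p → Halves ax (pos F a ⊕ (offset ⊕ along ax offset • ⟦ forward ax ⟧)) p (upper a))
        (sym (positions (cell a))) (halves-translate ax offset (halves a))) anchor

-- Iterated halving down to a single node.

Bounded : ∀ {n} → (Point → ℤ) → ℕ → Shape n → Set
Bounded f k S = ∀ u → ∃ λ i → f (pos S u) ≡ + i × i < 2 ^ k

coarse-bounded-along : ∀ {n} ax (F : Shape n) k → Bounded (along ax) (suc k) F →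
  Bounded (along ax) k (Coarsening.coarse ax F)
coarse-bounded-along ax F k bounded u with Coarsening.surjective ax F u
... | a , refl with bounded a
...   | i , eq , i<2^1+k = i ℕ./ 2 ,
  trans (cong (along ax) (Coarsening.lookup-cell ax F a)) (trans (along-halve ax (pos F a)) (cong half eq)) ,
  m<n*o⇒m/o<n (subst (i <_) (ℕₚ.*-comm 2 (2 ^ k)) i<2^1+k)

coarse-bounded-across : ∀ {n} ax (F : Shape n) k → Bounded (across ax) k F →
  Bounded (across ax) k (Coarsening.coarse ax F)
coarse-bounded-across ax F _ bounded u with Coarsening.surjective ax F u
... | a , refl with bounded a
...   | i , eq , i<2^k = i , trans (sym (across-≡ (Coarsening.halves ax F a))) eq , i<2^k

coincident⇒single : ∀ {n} (S : Shape n) → (∀ u v → pos S u ≡ pos S v) → n ≡ 1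
coincident⇒single {zero}        S _ with () ← nonempty S
coincident⇒single {suc zero}    S _ = refl
coincident⇒single {suc (suc n)} S eq with () ← pos-injective S (eq zero (suc zero))

manhattan-refl : ∀ p → manhattan p p ≡ 0
manhattan-refl (x , y) = cong₂ (λ i j → ∣ i ∣ + ∣ j ∣) (ℤₚ.+-inverseʳ x) (ℤₚ.+-inverseʳ y)

¬adjacent-refl : ∀ p → ¬ Adjacent p p
¬adjacent-refl p adj with () ← trans (sym (manhattan-refl p)) adj

grown-single : ∀ {n} (F : Shape n) → (∀ u v → pos F u ≡ pos F v) → Grown 0 F
grown-single F eq with refl ← coincident⇒single F eq = record
  { process   = start
  ; full      = λ adj → ⊥-elim (¬adjacent-refl (0ℤ , 0ℤ) adj)
  ; offset    = (0ℤ , 0ℤ) ⊖ pos F zero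
  ; positions = λ { zero → cong₂ _,_ (lemma (proj₁ (pos F zero))) (lemma (proj₂ (pos F zero))) }
  }
  where
  lemma : ∀ i → 0ℤ ≡ i ℤ.+ (0ℤ ℤ.- i)
  lemma = solve-∀

<1⇒≡0 : ∀ {i} → i < 1 → i ≡ 0
<1⇒≡0 (s≤s z≤n) = refl

-- Each call peels off the last step of the process, so the first `j` steps grow horizontally and
-- the remaining `k` vertically. With no step left, all coordinates are below `2 ^ 0` and the nodes
-- coincide.
grown : ∀ k j {n} (F : Shape n) → Bounded proj₂ k F → Bounded proj₁ j F → Grown (k + j) F
grown (suc k) j F bv bh = Coarsening.refine vertical F
  (grown k j _ (coarse-bounded-along vertical F k bv) (coarse-bounded-across vertical F j bh))
grown zero (suc j) F bv bh = Coarsening.refine horizontal F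
  (grown zero j _ (coarse-bounded-across horizontal F zero bv) (coarse-bounded-along horizontal F j bh))
grown zero zero F bv bh = grown-single F λ u v → trans (origin u) (sym (origin v))
  where
  zeroed : ∀ {i : ℤ} → (∃ λ k → i ≡ + k × k < 1) → i ≡ 0ℤ
  zeroed (k , eq , k<1) = trans eq (cong +_ (<1⇒≡0 k<1))
  origin : ∀ u → pos F u ≡ (0ℤ , 0ℤ)
  origin u = cong₂ _,_ (zeroed (bh u)) (zeroed (bv u))

translate : ∀ {n} → Shape n → Point → Shape n
translate S o = record
  { nonempty      = nonempty S
  ; pos           = λ u → pos S u ⊕ o
  ; pos-injective = λ eq → pos-injective S (⊕-cancelʳ o eq)
  ; Edge          = Edge S
  ; edge?         = edge? S
  ; edge-sym      = edge-sym S
  ; edge-adjacent = λ {u} {v} e → trans (manhattan-translate (pos S u) (pos S v) o) (edge-adjacent S e)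
  ; connected     = connected S
  }

-- A step without operations that only deletes edges: the growing steps create some edges of the
-- target merely through the adjacency closure, and cannot avoid creating others.
module Pruning {n} (S B : Shape n) (full : ∀ {u v} → Adjacent (pos B u) (pos B v) → Edge B u v)
    (o : Point) (positions : ∀ u → pos B u ≡ pos S u ⊕ o) (u₀ : Fin n) where

  ops : Operations n
  ops = record { direction = north ; grows = λ _ → false ; handover = λ _ _ → false }

  target : Shape n
  target = translate S o

  open Motion target ops

  ¬reattached : ∀ {u v} → ¬ Reattached u v
  ¬reattached ()

  module Potential = PotentialGrowth target ops u₀ (λ _ → 0ℤ)
    (λ {u} {v} _ → cong₂ ℤ._-_ (push-no target ops (¬reattached {u} {v})) (push-no target ops (¬reattached {v} {u})))
  open Potential using (tree; displacement-potential)

  noCollision : NoNodeCollision tree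
  noCollision p@(suc _) q@(suc _) _ _ {old u} {old v} eq = cong old (pos-injective target
    (•-cancelˡ (+ q) (⊕-cancelʳ ((+ p ℤ.* 0ℤ) • d) (trans (sym (still u)) (trans eq (still v))))))
    where
    still : ∀ u → scaledPosition tree p q (old u) ≡ (+ q) • pos target u ⊕ (+ p ℤ.* 0ℤ) • d
    still u = cong (λ s → (+ q) • pos target u ⊕ (+ p ℤ.* s) • d) (displacement-potential u)

  nodes : Node ops ↔ Fin n
  nodes = mk↔ₛ′ (λ { (old u) → u ; (new _ ()) }) old (λ _ → refl) (λ { (old _) → refl ; (new _ ()) })

  open Potential.Result nodes noCollision using (shape; growth)

  timeStep : TimeStep B u₀ shape u₀
  timeStep = record
    { Sᵈ       = target
    ; deletion = record
      { positions = λ u → sym (positions u)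
      ; edges     = λ {u} {v} e →
          full (subst₂ Adjacent (sym (positions u)) (sym (positions v)) (edge-adjacent target {u} {v} e))
      }
    ; growth   = growth
    }

  attachment-old : ∀ u v → attachment u v ≡ old u
  attachment-old u v with reattached? u v
  ... | no _ = refl

  newEdge⇒edge : ∀ {a b u v} → NewEdge a b → a ≡ old u → b ≡ old v → Edge S u v
  newEdge⇒edge (kept {u} {v} e) p q
    with refl ← trans (sym (attachment-old u v)) p | refl ← trans (sym (attachment-old v u)) q = e

  shape≅S : shape ≅ S
  shape≅S = record
    { nodes     = ↔-id (Fin n)
    ; offset    = (0ℤ , 0ℤ) ⊖ o
    ; positions = λ u → sym (trans
        (cong (λ k → (pos S u ⊕ o) ⊕ k • d ⊕ ((0ℤ , 0ℤ) ⊖ o)) (displacement-potential u))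
        (cong₂ _,_ (cancel (proj₁ (pos S u)) (proj₁ o) (proj₁ d)) (cancel (proj₂ (pos S u)) (proj₂ o) (proj₂ d))))
    ; edges     = λ u v → mk⇔
        (λ e → newEdge⇒edge e refl refl)
        (λ e → subst₂ NewEdge (attachment-old u v) (attachment-old v u) (kept e))
    }
    where
    cancel : ∀ x a c → ((x ℤ.+ a) ℤ.+ 0ℤ ℤ.* c) ℤ.+ (0ℤ ℤ.- a) ≡ x
    cancel = solve-∀

-- Serves the case in which both logarithms vanish and the bound permits no step.
single≅ : ∀ {n} (S : Shape n) → (∀ u v → pos S u ≡ pos S v) → singleNode ≅ S
single≅ S eq with refl ← coincident⇒single S eq = record
  { nodes     = ↔-id (Fin 1)
  ; offset    = pos S zero
  ; positions = λ { zero → cong₂ _,_ (sym (ℤₚ.+-identityˡ _)) (sym (ℤₚ.+-identityˡ _)) }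
  ; edges     = λ { zero zero → mk⇔ (λ ()) λ e → ¬adjacent-refl (pos S zero) (edge-adjacent S e) }
  }

-- The extent of a connected shape and its number of occupied lines.

minimum : ∀ {n} → NonZero n → (f : Fin n → ℤ) → ∃ λ a → ∀ u → f a ℤ.≤ f u
minimum {suc zero}    _ f = zero , λ { zero → ℤₚ.≤-refl }
minimum {suc (suc n)} _ f with minimum _ (f ∘ suc)
... | a , least with ℤₚ.≤-total (f zero) (f (suc a))
...   | inj₁ f0≤ = zero , λ { zero → ℤₚ.≤-refl ; (suc u) → ℤₚ.≤-trans f0≤ (least u) }
...   | inj₂ ≤f0 = suc a , λ { zero → ≤f0 ; (suc u) → least u }

-- Unfolds to `rows` for `vertical` and to `columns` for `horizontal`.
lines : ∀ {n} → Axis → Shape n → ℕ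
lines ax S = length (deduplicate ℤ._≟_ (map (along ax) (tabulate (pos S))))

module Extent {n} (ax : Axis) (S : Shape n) where

  level : Fin n → ℤ
  level u = along ax (pos S u)

  lowest : Fin n
  lowest = proj₁ (minimum (nonempty S) level)

  height : Fin n → ℕ
  height u = ∣ level u ℤ.- level lowest ∣

  level-height : ∀ u → level u ≡ level lowest ℤ.+ + height u
  level-height u = trans (split (level u) (level lowest)) (cong (λ i → level lowest ℤ.+ i)
    (sym (ℤₚ.0≤i⇒+∣i∣≡i (ℤₚ.i≤j⇒0≤j-i (proj₂ (minimum (nonempty S) level) u)))))
    where
    split : ∀ i j → i ≡ j ℤ.+ (i ℤ.- j)
    split = solve-∀

  height-≡ : ∀ {u k} → level u ≡ level lowest ℤ.+ + k → height u ≡ k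
  height-≡ {u} eq = ℤₚ.+-injective (+-cancelˡ (level lowest) _ _ (trans (sym (level-height u)) eq))

  height-suc : ∀ {u v} → level v ≡ level u ℤ.+ 1ℤ → height v ≡ suc (height u)
  height-suc {u} {v} eq = height-≡ (begin
    level v                                    ≡⟨ eq ⟩
    level u ℤ.+ 1ℤ                             ≡⟨ cong (λ i → i ℤ.+ 1ℤ) (level-height u) ⟩
    level lowest ℤ.+ + height u ℤ.+ 1ℤ         ≡⟨ ℤₚ.+-assoc (level lowest) (+ height u) 1ℤ ⟩
    level lowest ℤ.+ + (height u + 1)          ≡⟨ cong (λ k → level lowest ℤ.+ + k) (ℕₚ.+-comm (height u) 1) ⟩
    level lowest ℤ.+ + suc (height u)          ∎)
    where open ≡-Reasoning

  height-step : ∀ {u v} → Edge S u v → height v ≤ suc (height u)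
  height-step {u} {v} e with adjacent⇒neighbours ax _ _ (edge-adjacent S e)
  ... | ahead  a _ = ℕₚ.≤-reflexive (height-suc a)
  ... | behind a _ = ℕₚ.m≤n⇒m≤1+n (ℕₚ.≤-trans (ℕₚ.n≤1+n (height v)) (ℕₚ.≤-reflexive (sym (height-suc a))))
  ... | beside a _ = ℕₚ.m≤n⇒m≤1+n (ℕₚ.≤-reflexive (sym (height-≡ (trans a (level-height v)))))

  Attained : ℕ → Set
  Attained k = ∃ λ w → height w ≡ k

  -- A discrete intermediate value theorem: each edge raises the height by at most one, so a walk
  -- skips no height on its way up.
  attained-along : ∀ {u v} → (∀ {k} → k ≤ height u → Attained k) → Star (Edge S) u v →
    ∀ {k} → k ≤ height v → Attained k
  attained-along below ε = below
  attained-along {u} below (_◅_ {j = w} e es) = attained-along below′ es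
    where
    below′ : ∀ {k} → k ≤ height w → Attained k
    below′ {k} k≤ with ℕₚ.m≤n⇒m<n∨m≡n k≤
    ... | inj₂ k≡ = w , sym k≡
    ... | inj₁ k< = below (ℕₚ.≤-pred (ℕₚ.≤-trans k< (height-step e)))

  attained : ∀ v {k} → k ≤ height v → Attained k
  attained v = attained-along base (connected S lowest v)
    where
    height-lowest : height lowest ≡ 0
    height-lowest = cong ∣_∣ (ℤₚ.+-inverseʳ (level lowest))
    base : ∀ {k} → k ≤ height lowest → Attained k
    base k≤ = lowest , trans height-lowest (sym (ℕₚ.n≤0⇒n≡0 (subst (_ ≤_) height-lowest k≤)))

  -- The heights from `0` to `height u` are all attained, on distinct levels, which injects them
  -- into the list of occupied lines.
  height<lines : ∀ u → height u < lines ax S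
  height<lines u = Finₚ.injective⇒≤ line-injective
    where
    witness : ∀ (k : Fin (suc (height u))) → Attained (Fin.toℕ k)
    witness k = attained u (ℕₚ.≤-pred (Finₚ.toℕ<n k))
    levels : List ℤ
    levels = deduplicate ℤ._≟_ (map (along ax) (tabulate (pos S)))
    level∈levels : ∀ w → level w ∈ levels
    level∈levels w = ∈-deduplicate⁺ ℤ._≟_ (∈-map⁺ (along ax) (∈-tabulate⁺ {f = pos S} w))
    line : Fin (suc (height u)) → Fin (lines ax S)
    line k = index (level∈levels (proj₁ (witness k)))
    line-injective : Injective _≡_ _≡_ line
    line-injective {k} {l} eq = Finₚ.toℕ-injective (trans (sym (proj₂ (witness k)))
      (trans (cong (λ i → ∣ i ℤ.- level lowest ∣) sameLevel) (proj₂ (witness l))))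
      where
      sameLevel : level (proj₁ (witness k)) ≡ level (proj₁ (witness l))
      sameLevel = trans (lookup-index (level∈levels (proj₁ (witness k))))
        (trans (cong (lookup levels) eq) (sym (lookup-index (level∈levels (proj₁ (witness l))))))

-- Counting the steps logarithmically.

n<2^1+⌊log₂n⌋ : ∀ n → n < 2 ^ suc ⌊log₂ n ⌋
-- If the power were at most `n`, monotonicity of the logarithm would make it exceed itself by one.
n<2^1+⌊log₂n⌋ n = ℕₚ.≰⇒> λ 2^≤n → ℕₚ.1+n≰n
  (subst (_≤ ⌊log₂ n ⌋) (⌊log₂[2^n]⌋≡n (suc ⌊log₂ n ⌋)) (⌊log₂⌋-mono-≤ 2^≤n))

module Normalised {n} (S : Shape n) where

  module V = Extent vertical S
  module H = Extent horizontal S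

  origin : Point
  origin = ℤ.- H.level H.lowest , ℤ.- V.level V.lowest

  normalised : Shape n
  normalised = translate S origin

  normalised-height : ∀ ax u → along ax (pos normalised u) ≡ + Extent.height ax S u
  normalised-height ax u = trans (relative ax)
    (trans (cong (λ i → i ℤ.- level lowest) (level-height u)) (cancel (level lowest) (+ height u)))
    where
    open Extent ax S
    relative : ∀ ax → along ax (pos normalised u) ≡ along ax (pos S u) ℤ.- along ax (pos S (Extent.lowest ax S))
    relative vertical   = refl
    relative horizontal = refl
    cancel : ∀ i j → (i ℤ.+ j) ℤ.- i ≡ j
    cancel = solve-∀

  bounded : ∀ ax → Bounded (along ax) (suc ⌊log₂ lines ax S ⌋) normalised
  bounded ax u = Extent.height ax S u , normalised-height ax u ,
    ℕₚ.<-trans (Extent.height<lines ax S u) (n<2^1+⌊log₂n⌋ (lines ax S))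

  -- One step for each halving in either direction, and the outer `suc` for the deletion at the end.
  growsIn : GrowsIn singleNode S (suc (suc ⌊log₂ rows S ⌋ + suc ⌊log₂ columns S ⌋))
  growsIn = by zero process P.timeStep P.shape≅S
    where
    open Grown (grown (suc ⌊log₂ rows S ⌋) (suc ⌊log₂ columns S ⌋) normalised
      (bounded vertical) (bounded horizontal))
    module P = Pruning S shape full (origin ⊕ offset)
      (λ u → trans (positions u) (⊕-assoc (pos S u) origin offset)) anchor

  coincident : ⌊log₂ rows S ⌋ ≡ 0 → ⌊log₂ columns S ⌋ ≡ 0 → ∀ u v → pos S u ≡ pos S v
  coincident r c u v = ⊕-cancelʳ origin (trans (atOrigin u) (sym (atOrigin v)))
    where
    flat : ∀ ax → ⌊log₂ lines ax S ⌋ ≡ 0 → ∀ w → along ax (pos normalised w) ≡ 0ℤ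
    -- A logarithm of `0` leaves fewer than two lines, so every height is below `1`.
    flat ax eq w = trans (normalised-height ax w) (cong +_ (<1⇒≡0 (ℕₚ.<-≤-trans (Extent.height<lines ax S w)
      (ℕₚ.≤-pred (subst (λ k → lines ax S < 2 ^ suc k) eq (n<2^1+⌊log₂n⌋ (lines ax S)))))))
    atOrigin : ∀ w → pos normalised w ≡ (0ℤ , 0ℤ)
    atOrigin w = cong₂ _,_ (flat horizontal c w) (flat vertical r w)

-- The three extra steps are paid for by `3 * (r + c)`, whence the constant `4`.
steps-bound : ∀ r c → 0 < r + c → suc (suc r + suc c) ≤ 4 * (r + c)
steps-bound r c 0<r+c = begin
  suc (suc r + suc c)       ≡⟨ lemma r c ⟩
  (r + c) + 3 * 1           ≤⟨ ℕₚ.+-monoʳ-≤ (r + c) (ℕₚ.*-monoʳ-≤ 3 0<r+c) ⟩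
  (r + c) + 3 * (r + c)     ∎
  where
  open ℕₚ.≤-Reasoning
  lemma : ∀ r c → suc (suc r + suc c) ≡ (r + c) + 3
  lemma = ℕ-Solver.solve-∀

theorem4p2 : ∃ λ (C : ℕ) → ∀ {n} (S : Shape n) →
    ∃ λ (t : ℕ) → t ≤ C * (⌊log₂ rows S ⌋ + ⌊log₂ columns S ⌋) × GrowsIn singleNode S t
theorem4p2 = 4 , λ S → grow S
  where
  grow : ∀ {n} (S : Shape n) →
    ∃ λ (t : ℕ) → t ≤ 4 * (⌊log₂ rows S ⌋ + ⌊log₂ columns S ⌋) × GrowsIn singleNode S t
  -- A sum of `0` forces zero steps, so the single node must be recognised as `S` directly, without
  -- even the deleting step.
  grow S with ⌊log₂ rows S ⌋ + ⌊log₂ columns S ⌋ ℕ.≟ 0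
  ... | yes r+c≡0 = 0 , z≤n , immediately (single≅ S (Normalised.coincident S
          (ℕₚ.m+n≡0⇒m≡0 ⌊log₂ rows S ⌋ r+c≡0) (ℕₚ.m+n≡0⇒n≡0 ⌊log₂ rows S ⌋ r+c≡0)))
  ... | no  r+c≢0 = _ , steps-bound _ _ (ℕₚ.n≢0⇒n>0 r+c≢0) , Normalised.growsIn S
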